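{- No randomized algorithm can obtain an approximation strictly better than $O(n^{ -1/2+\delta})$ to maximizing monotone submodular functions under a cardinality constraint using $e^{n^{\delta}}/n$ queries to an $\epsilon$-erroneous oracle, for any fixed $\epsilon,\delta<1/2$.
   Context: $N$ is a ground set of size $n$. A function $f:2^N\to\mathbb{R}$ is monotone if $S\subseteq T$ implies $f(S)\le f(T)$, and submodular if $f(S\cup T)\le f(S)+f(T)-f(S\cap T)$ for all $S,T\subseteq N$. Maximizing under a cardinality constraint is the problem $\max_{S:|S|\le k}f(S)$; an approximation of $\alpha$ means that the value $f(S)$ of the solution is at least $\alpha$ times this maximum. For $\epsilon>0$, a function $\widetilde f:2^N\to\mathbb{R}$ is $\epsilon$-erroneous (an $\epsilon$-erroneous oracle of $f$) if $(1-\epsilon)f(S)\le\widetilde f(S)\le(1+\epsilon)f(S)$ for every $S\subseteq N$. The algorithm has access only to $\widetilde f$, and a query consists of a set $S$ and returns $\widetilde f(S)$. -}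

module Defs where

open import Algebra.Definitions.RawMonoid as RawMonoidDefs using ()
open import Algebra.Definitions.RawSemiring as RawSemiringDefs using ()
open import Algebra.Properties.Semiring.Exp as Exp using ()
open import Algebra.Bundles using (CommutativeRing)
open import Data.Bool.Base using (true; false)
open import Data.Empty using (⊥-elim)
open import Data.Fin.Base using (Fin)
open import Data.Fin.Subset as Subset using (Subset; _⊆_; _∪_; _∩_; ∣_∣)
open import Data.Fin.Subset.Properties using (∣⊥∣≡0)
open import Data.Integer.Base as ℤ using (ℤ; +_; -[1+_])
import Data.Integer.Properties as ℤ
open import Data.Nat.Base as ℕ using (ℕ; zero; suc; _!)
import Data.Nat.Properties as ℕ
open import Data.Product using (Σ; ∃; _×_; _,_; proj₁; proj₂)
open import Data.Rational as ℚ using (ℚ; mkℚ; 0ℚ; 1ℚ; ½; _/_; ↥_; ↧ₙ_)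
import Data.Rational.Properties as ℚ
open import Data.Rational.Unnormalised as ℚᵘ using (mkℚᵘ)
import Data.Rational.Unnormalised.Properties as ℚᵘ
open import Data.Sum.Base using (_⊎_; inj₁; inj₂)
open import Data.Vec.Base using ([]; _∷_)
open import Relation.Binary.PropositionalEquality using (_≡_; refl; sym; trans; cong; subst)
open import Relation.Nullary using (¬_; yes; no)

private
  module Q^ = Exp (CommutativeRing.semiring ℚ.+-*-commutativeRing)

open RawSemiringDefs ℚ.+-*-rawSemiring public using () renaming (_^_ to _^ℚ_)
open RawMonoidDefs ℚ.+-0-rawMonoid public using () renaming (sum to sumℚ)

-- Reals are the textbook one-sided Dedekind cuts: x ∋ q means q < x, and
-- x ∌ r means x ≤ r.  Cuts are not required to be located, which is
-- automatic classically; constructively the type may have more members.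

infix 4 _∋_ _∌_

record ℝ : Set₁ where
  field
    below     : ℚ → Set
    inhabited : ∃ λ q → below q
    proper    : ∃ λ q → ¬ below q
    down      : ∀ {p q} → p ℚ.≤ q → below q → below p
    rounded   : ∀ {p} → below p → ∃ λ q → p ℚ.< q × below q

_∋_ : ℝ → ℚ → Set
x ∋ q = ℝ.below x q

_∌_ : ℝ → ℚ → Set
x ∌ q = ¬ (x ∋ q)

below≤above : ∀ x {p q} → x ∋ p → x ∌ q → p ℚ.≤ q
below≤above x {p} {q} x∋p x∌q with ℚ.≤-total p q
... | inj₁ p≤q = p≤q
... | inj₂ q≤p = ⊥-elim (x∌q (ℝ.down x q≤p x∋p))

infix 4 _≤_ _<_

_≤_ : ℝ → ℝ → Set
x ≤ y = ∀ {q} → x ∋ q → y ∋ q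

_<_ : ℝ → ℝ → Set
x < y = ∃ λ q → x ∌ q × y ∋ q

sup : (P : ℚ → Set) → ∃ P → (∃ λ b → ∀ {u} → P u → u ℚ.≤ b) → ℝ
sup P (u₀ , Pu₀) (b , P≤b) = record
  { below     = λ q → ∃ λ u → P u × q ℚ.< u
  ; inhabited = u₀ ℚ.- 1ℚ , u₀ , Pu₀ , u-1<u
  ; proper    = b , λ (u , Pu , b<u) → ℚ.<-irrefl refl (ℚ.<-≤-trans b<u (P≤b Pu))
  ; down      = λ p≤q (u , Pu , q<u) → u , Pu , ℚ.≤-<-trans p≤q q<u
  ; rounded   = λ (u , Pu , p<u) → let (q , p<q , q<u) = ℚ.<-dense p<u in q , p<q , u , Pu , q<u
  }
  where
  u-1<u : u₀ ℚ.- 1ℚ ℚ.< u₀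
  u-1<u = subst (u₀ ℚ.- 1ℚ ℚ.<_) (ℚ.+-identityʳ u₀) (ℚ.+-monoʳ-< u₀ (ℚ.negative⁻¹ (ℚ.- 1ℚ)))

fromℚ : ℚ → ℝ
fromℚ r = sup (_≡ r) (r , refl) (r , ℚ.≤-reflexive)

fromℕ : ℕ → ℝ
fromℕ n = fromℚ (+ n / 1)

0ℝ 1ℝ ½ℝ : ℝ
0ℝ = fromℚ 0ℚ
1ℝ = fromℚ 1ℚ
½ℝ = fromℚ ½

infixl 6 _+_ _-_
infixl 7 _*_
infix  8 -_

_+_ : ℝ → ℝ → ℝ
x + y = sup
  (λ u → ∃ λ a → ∃ λ b → x ∋ a × y ∋ b × u ≡ a ℚ.+ b)
  (let (a , x∋a) = ℝ.inhabited x ; (b , y∋b) = ℝ.inhabited y in _ , a , b , x∋a , y∋b , refl)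
  (let (a′ , x∌a′) = ℝ.proper x ; (b′ , y∌b′) = ℝ.proper y in
   a′ ℚ.+ b′ , λ { (a , b , x∋a , y∋b , refl) →
     ℚ.+-mono-≤ (below≤above x x∋a x∌a′) (below≤above y y∋b y∌b′) })

-_ : ℝ → ℝ
- x = sup
  (λ u → ∃ λ r → x ∌ r × u ≡ ℚ.- r)
  (let (r , x∌r) = ℝ.proper x in _ , r , x∌r , refl)
  (let (a , x∋a) = ℝ.inhabited x in
   ℚ.- a , λ { (r , x∌r , refl) → ℚ.neg-antimono-≤ (below≤above x x∋a x∌r) })

_-_ : ℝ → ℝ → ℝ
x - y = x + (- y)

private
  _≤⟨⟩_ = ℚ.≤-trans
  infixr 2 _≤⟨⟩_

  corner-≤ : ∀ {u} a {c d t} → u ℚ.≤ a ℚ.* c → u ℚ.≤ a ℚ.* d → c ℚ.≤ t → t ℚ.≤ d → u ℚ.≤ a ℚ.* t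
  corner-≤ a ac ad c≤t t≤d with ℚ.≤-total 0ℚ a
  ... | inj₁ 0≤a = ac ≤⟨⟩ ℚ.*-monoˡ-≤-nonNeg a {{ℚ.nonNegative 0≤a}} c≤t
  ... | inj₂ a≤0 = ad ≤⟨⟩ ℚ.*-monoˡ-≤-nonPos a {{ℚ.nonPositive a≤0}} t≤d

  corner-≥ : ∀ {u} a {c d t} → a ℚ.* c ℚ.≤ u → a ℚ.* d ℚ.≤ u → c ℚ.≤ t → t ℚ.≤ d → a ℚ.* t ℚ.≤ u
  corner-≥ a ac ad c≤t t≤d with ℚ.≤-total 0ℚ a
  ... | inj₁ 0≤a = ℚ.*-monoˡ-≤-nonNeg a {{ℚ.nonNegative 0≤a}} t≤d ≤⟨⟩ ad
  ... | inj₂ a≤0 = ℚ.*-monoˡ-≤-nonPos a {{ℚ.nonPositive a≤0}} c≤t ≤⟨⟩ ac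

  swap-≤ : ∀ {u} a b → u ℚ.≤ a ℚ.* b → u ℚ.≤ b ℚ.* a
  swap-≤ a b = subst (_ ℚ.≤_) (ℚ.*-comm a b)

  swap-≥ : ∀ {u} a b → a ℚ.* b ℚ.≤ u → b ℚ.* a ℚ.≤ u
  swap-≥ a b = subst (ℚ._≤ _) (ℚ.*-comm a b)

-- Interval multiplication: if x ∈ (a , b] and y ∈ (c , d] then x y is at
-- least the smallest of the four products of end points.
_*_ : ℝ → ℝ → ℝ
x * y = sup P inh bd
  where
  P : ℚ → Set
  P u = ∃ λ a → ∃ λ b → ∃ λ c → ∃ λ d →
    x ∋ a × x ∌ b × y ∋ c × y ∌ d ×
    u ℚ.≤ a ℚ.* c × u ℚ.≤ a ℚ.* d × u ℚ.≤ b ℚ.* c × u ℚ.≤ b ℚ.* d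

  inh : ∃ P
  inh with ℝ.inhabited x | ℝ.proper x | ℝ.inhabited y | ℝ.proper y
  ... | a , xa | b , xb | c , yc | d , yd =
    (ac ℚ.⊓ ad) ℚ.⊓ (bc ℚ.⊓ bd) , a , b , c , d , xa , xb , yc , yd ,
    (ℚ.p⊓q≤p _ _ ≤⟨⟩ ℚ.p⊓q≤p ac ad) , (ℚ.p⊓q≤p _ _ ≤⟨⟩ ℚ.p⊓q≤q ac ad) ,
    (ℚ.p⊓q≤q (ac ℚ.⊓ ad) _ ≤⟨⟩ ℚ.p⊓q≤p bc bd) , (ℚ.p⊓q≤q (ac ℚ.⊓ ad) _ ≤⟨⟩ ℚ.p⊓q≤q bc bd)
    where
    ac = a ℚ.* c
    ad = a ℚ.* d
    bc = b ℚ.* c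
    bd = b ℚ.* d

  bd : ∃ λ M → ∀ {u} → P u → u ℚ.≤ M
  bd with ℝ.inhabited x | ℝ.proper x | ℝ.inhabited y | ℝ.proper y
  ... | a₀ , xa₀ | b₀ , xb₀ | c₀ , yc₀ | d₀ , yd₀ = M , bound
    where
    a₀c₀ = a₀ ℚ.* c₀
    a₀d₀ = a₀ ℚ.* d₀
    b₀c₀ = b₀ ℚ.* c₀
    b₀d₀ = b₀ ℚ.* d₀
    M = (a₀c₀ ℚ.⊔ a₀d₀) ℚ.⊔ (b₀c₀ ℚ.⊔ b₀d₀)
    bound : ∀ {u} → P u → u ℚ.≤ M
    bound (a , b , c , d , xa , xb , yc , yd , ac , ad , bc , bd) =
      swap-≤ t s (corner-≤ t
        (swap-≤ a t (corner-≤ a ac ad c≤t t≤d)) (swap-≤ b t (corner-≤ b bc bd c≤t t≤d)) a≤s s≤b)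
      ≤⟨⟩
      swap-≥ t s (corner-≥ t
        (swap-≥ a₀ t (corner-≥ a₀ (ℚ.p≤p⊔q _ _ ≤⟨⟩ ℚ.p≤p⊔q _ _) (ℚ.p≤q⊔p a₀c₀ _ ≤⟨⟩ ℚ.p≤p⊔q _ _) c₀≤t t≤d₀))
        (swap-≥ b₀ t (corner-≥ b₀ (ℚ.p≤p⊔q _ _ ≤⟨⟩ ℚ.p≤q⊔p (a₀c₀ ℚ.⊔ a₀d₀) _)
                                  (ℚ.p≤q⊔p b₀c₀ _ ≤⟨⟩ ℚ.p≤q⊔p (a₀c₀ ℚ.⊔ a₀d₀) _) c₀≤t t≤d₀))
        a₀≤s s≤b₀)
      where
      s = a ℚ.⊔ a₀
      t = c ℚ.⊔ c₀
      a≤s  = ℚ.p≤p⊔q a a₀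
      a₀≤s = ℚ.p≤q⊔p a a₀
      c≤t  = ℚ.p≤p⊔q c c₀
      c₀≤t = ℚ.p≤q⊔p c c₀
      s≤b  = ℚ.⊔-lub (below≤above x xa xb) (below≤above x xa₀ xb)
      s≤b₀ = ℚ.⊔-lub (below≤above x xa xb₀) (below≤above x xa₀ xb₀)
      t≤d  = ℚ.⊔-lub (below≤above y yc yd) (below≤above y yc₀ yd)
      t≤d₀ = ℚ.⊔-lub (below≤above y yc yd₀) (below≤above y yc₀ yd₀)

-- PowerBound b u i d: the rational u is at most c ^ (i / d), where c is
-- a lower bound of b if i ≥ 0 and an upper bound of b if i < 0 (so that
-- c ^ (i / d) ≤ b ^ (i / d) in both cases).
PowerBound : ℝ → ℚ → ℤ → ℕ → Set
PowerBound b u (+ k)    d = ∃ λ c → b ∋ c × 0ℚ ℚ.≤ c × u ^ℚ d ℚ.≤ c ^ℚ k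
PowerBound b u -[1+ k ] d = ∃ λ c → b ∌ c × u ^ℚ d ℚ.* c ^ℚ suc k ℚ.≤ 1ℚ

private
  0≤1 : 0ℚ ℚ.≤ 1ℚ
  0≤1 = ℚ.nonNegative⁻¹ 1ℚ

  mono* : ∀ {a b c d} → 0ℚ ℚ.≤ a → 0ℚ ℚ.≤ d → a ℚ.≤ b → c ℚ.≤ d → a ℚ.* c ℚ.≤ b ℚ.* d
  mono* {a} {d = d} 0≤a 0≤d a≤b c≤d =
    ℚ.*-monoˡ-≤-nonNeg a {{ℚ.nonNegative 0≤a}} c≤d ≤⟨⟩ ℚ.*-monoʳ-≤-nonNeg d {{ℚ.nonNegative 0≤d}} a≤b

  ^-nonNeg : ∀ {x} n → 0ℚ ℚ.≤ x → 0ℚ ℚ.≤ x ^ℚ n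
  ^-nonNeg zero    0≤x = 0≤1
  ^-nonNeg {x} (suc n) 0≤x =
    subst (ℚ._≤ x ℚ.* x ^ℚ n) (ℚ.*-zeroˡ 0ℚ) (mono* ℚ.≤-refl (^-nonNeg n 0≤x) 0≤x (^-nonNeg n 0≤x))

  ^-mono : ∀ {x y} n → 0ℚ ℚ.≤ x → x ℚ.≤ y → x ^ℚ n ℚ.≤ y ^ℚ n
  ^-mono zero    0≤x x≤y = ℚ.≤-refl
  ^-mono (suc n) 0≤x x≤y = mono* 0≤x (^-nonNeg n (0≤x ≤⟨⟩ x≤y)) x≤y (^-mono n 0≤x x≤y)

  ^-mono-< : ∀ {x y} n → 0ℚ ℚ.≤ x → x ℚ.< y → x ^ℚ suc n ℚ.< y ^ℚ suc n
  ^-mono-< {x} {y} zero 0≤x x<y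
    rewrite ℚ.*-identityʳ x | ℚ.*-identityʳ y = x<y
  ^-mono-< {x} {y} (suc n) 0≤x x<y = ℚ.≤-<-trans
    (ℚ.*-monoˡ-≤-nonNeg x {{ℚ.nonNegative 0≤x}} (ℚ.<⇒≤ ih))
    (ℚ.*-monoˡ-<-pos (y ^ℚ suc n) {{ℚ.positive (ℚ.≤-<-trans (^-nonNeg (suc n) 0≤x) ih)}} x<y)
    where ih = ^-mono-< n 0≤x x<y

  1≤^ : ∀ {x} n → 1ℚ ℚ.≤ x → 1ℚ ℚ.≤ x ^ℚ n
  1≤^ zero    1≤x = ℚ.≤-refl
  1≤^ {x} (suc n) 1≤x = mono* 0≤1 (0≤1 ≤⟨⟩ 1≤^ n 1≤x) 1≤x (1≤^ n 1≤x)

  ^-monoʳ : ∀ {x m n} → 1ℚ ℚ.≤ x → m ℕ.≤ n → x ^ℚ m ℚ.≤ x ^ℚ n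
  ^-monoʳ {n = n} 1≤x ℕ.z≤n = 1≤^ n 1≤x
  ^-monoʳ {x} {suc m} 1≤x (ℕ.s≤s m≤n) =
    ℚ.*-monoˡ-≤-nonNeg x {{ℚ.nonNegative (0≤1 ≤⟨⟩ 1≤x)}} (^-monoʳ 1≤x m≤n)

  fromℕᵘ : ∀ n → ℚ.toℚᵘ (+ n / 1) ℚᵘ.≃ mkℚᵘ (+ n) 0
  fromℕᵘ n = ℚ.toℚᵘ-fromℚᵘ (mkℚᵘ (+ n) 0)

  archimedean : ∀ v → ∃ λ N → v ℚ.≤ + N / 1
  archimedean v@(mkℚ i d _) = ℤ.∣ i ∣ , ℚ.toℚᵘ-cancel-≤
    (ℚᵘ.≤-respʳ-≃ (ℚᵘ.≃-sym (fromℕᵘ ℤ.∣ i ∣)) (ℚᵘ.*≤* (i≤ i)))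
    where
    i≤ : ∀ j → j ℤ.* + 1 ℤ.≤ + ℤ.∣ j ∣ ℤ.* + suc d
    i≤ (+ k) = subst (+ k ℤ.* + 1 ℤ.≤_) refl (ℤ.*-monoˡ-≤-nonNeg (+ k) (ℤ.+≤+ (ℕ.s≤s ℕ.z≤n)))
    i≤ -[1+ k ] = ℤ.-≤+

  numerator≤ : ∀ p {k N} → ↥ p ≡ + k → p ℚ.≤ + N / 1 → k ℕ.≤ N ℕ.* ↧ₙ p
  numerator≤ (mkℚ (+ k) d _) {N = N} refl p≤N with ℚᵘ.≤-respʳ-≃ (fromℕᵘ N) (ℚ.toℚᵘ-mono-≤ p≤N)
  ... | ℚᵘ.*≤* le = ℤ.drop‿+≤+
    (ℤ.≤-trans (ℤ.≤-reflexive (sym (ℤ.*-identityʳ (+ k))))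
      (ℤ.≤-trans le (ℤ.≤-reflexive (sym (ℤ.pos-* N (suc d))))))

  0∈ : ∀ b → 1ℝ ≤ b → b ∋ 0ℚ
  0∈ b 1≤b = 1≤b (1ℚ , refl , ℚ.positive⁻¹ 1ℚ)

  1≤above : ∀ b → 1ℝ ≤ b → ∀ {c} → b ∌ c → 1ℚ ℚ.≤ c
  1≤above b 1≤b {c} b∌c with ℚ.≤-total 1ℚ c
  ... | inj₁ 1≤c = 1≤c
  ... | inj₂ c≤1 with c ℚ.≟ 1ℚ
  ...   | yes refl = ℚ.≤-refl
  ...   | no  c≢1  = ⊥-elim (b∌c (1≤b (1ℚ , refl , ℚ.≰⇒> λ 1≤c → c≢1 (ℚ.≤-antisym c≤1 1≤c))))

-- For b ≥ 1, b ^ x = sup { b ^ s : s rational, s < x }.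
pow : (b : ℝ) → 1ℝ ≤ b → ℝ → ℝ
pow b 1≤b x = sup P inh bd
  where
  P : ℚ → Set
  P u = 0ℚ ℚ.≤ u × ∃ λ s → x ∋ s × PowerBound b u (↥ s) (↧ₙ s)

  0-bound : ∀ i d → PowerBound b 0ℚ i (suc d)
  0-bound (+ k) d = 0ℚ , 0∈ b 1≤b , ℚ.≤-refl ,
    subst (ℚ._≤ 0ℚ ^ℚ k) (sym (ℚ.*-zeroˡ (0ℚ ^ℚ d))) (^-nonNeg k ℚ.≤-refl)
  0-bound -[1+ k ] d = c , b∌c ,
    subst (ℚ._≤ 1ℚ) (sym (trans (cong (ℚ._* c ^ℚ suc k) (ℚ.*-zeroˡ (0ℚ ^ℚ d))) (ℚ.*-zeroˡ (c ^ℚ suc k)))) 0≤1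
    where
    c   = proj₁ (ℝ.proper b)
    b∌c = proj₂ (ℝ.proper b)

  inh : ∃ P
  inh with ℝ.inhabited x
  ... | s@(mkℚ i d _) , x∋s = 0ℚ , ℚ.≤-refl , s , x∋s , 0-bound i d

  bd : ∃ λ M → ∀ {u} → P u → u ℚ.≤ M
  bd with ℝ.proper b | ℝ.proper x
  ... | B , b∌B | v , x∌v with archimedean v
  ...   | N , v≤N = B ^ℚ N , bound
    where
    1≤B : 1ℚ ℚ.≤ B
    1≤B = 1≤above b 1≤b b∌B

    root : ∀ {u} d → u ^ℚ suc d ℚ.≤ (B ^ℚ N) ^ℚ suc d → u ℚ.≤ B ^ℚ N
    root {u} d le with u ℚ.≤? B ^ℚ N
    ... | yes p = p
    ... | no ¬p = ⊥-elim (ℚ.<-irrefl refl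
      (ℚ.<-≤-trans (^-mono-< d (0≤1 ≤⟨⟩ 1≤^ N 1≤B) (ℚ.≰⇒> ¬p)) le))

    bound : ∀ {u} → P u → u ℚ.≤ B ^ℚ N
    bound {u} (0≤u , s@(mkℚ (+ k) d _) , x∋s , c , b∋c , 0≤c , u^d≤c^k) = root d
      (u^d≤c^k ≤⟨⟩ ^-mono k 0≤c (below≤above b b∋c b∌B)
       ≤⟨⟩ ^-monoʳ 1≤B (numerator≤ s {N = N} refl (below≤above x x∋s x∌v ≤⟨⟩ v≤N))
       ≤⟨⟩ ℚ.≤-reflexive (sym (Q^.^-assocʳ B N (suc d))))
    bound {u} (0≤u , mkℚ -[1+ k ] d _ , x∋s , c , b∌c , u^d*c≤1) = root d
      (subst (ℚ._≤ u ^ℚ suc d ℚ.* c ^ℚ suc k) (ℚ.*-identityʳ _)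
         (ℚ.*-monoˡ-≤-nonNeg (u ^ℚ suc d) {{ℚ.nonNegative (^-nonNeg (suc d) 0≤u)}}
           (1≤^ (suc k) (1≤above b 1≤b b∌c)))
       ≤⟨⟩ u^d*c≤1 ≤⟨⟩ 1≤^ (suc d) (1≤^ N 1≤B))

1≤fromℕ : ∀ n .{{_ : ℕ.NonZero n}} → 1ℝ ≤ fromℕ n
1≤fromℕ n (u , refl , q<1) = + n / 1 , refl , ℚ.<-≤-trans q<1
  (ℚ.toℚᵘ-cancel-≤ (ℚᵘ.≤-respʳ-≃ (ℚᵘ.≃-sym (fromℕᵘ n))
    (ℚᵘ.*≤* (subst (+ 1 ℤ.≤_) (sym (ℤ.*-identityʳ (+ n))) (ℤ.+≤+ (ℕ.>-nonZero⁻¹ n))))))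

infixr 8 _^_ e^_

_^_ : (n : ℕ) .{{_ : ℕ.NonZero n}} → ℝ → ℝ
n ^ x = pow (fromℕ n) (1≤fromℕ n) x

invFact : ℕ → ℚ
invFact m = (+ 1 / (m !)) {{m ℕ.!≢0}}

expSum : ℕ → ℚ
expSum zero    = invFact 0
expSum (suc m) = expSum m ℚ.+ invFact (suc m)

private
  half : ∀ m n .{{_ : ℕ.NonZero m}} .{{_ : ℕ.NonZero n}} → 2 ℕ.* m ℕ.≤ n →
         + 1 / n ℚ.+ + 1 / n ℚ.≤ + 1 / m
  half (suc m) (suc n) 2m≤n = ℚ.toℚᵘ-cancel-≤
    (ℚᵘ.≤-respʳ-≃ (ℚᵘ.≃-sym (ℚ.toℚᵘ-fromℚᵘ (mkℚᵘ (+ 1) m)))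
      (ℚᵘ.≤-respˡ-≃ (ℚᵘ.≃-sym (ℚᵘ.≃-trans (ℚ.toℚᵘ-homo-+ (+ 1 / suc n) (+ 1 / suc n))
          (ℚᵘ.+-cong (ℚ.toℚᵘ-fromℚᵘ (mkℚᵘ (+ 1) n)) (ℚ.toℚᵘ-fromℚᵘ (mkℚᵘ (+ 1) n)))))
        (ℚᵘ.*≤* (ℤ.+≤+ (lemma (suc m) (suc n) 2m≤n)))))
    where
    lemma : ∀ m n → 2 ℕ.* m ℕ.≤ n → (1 ℕ.* n ℕ.+ 1 ℕ.* n) ℕ.* m ℕ.≤ 1 ℕ.* (n ℕ.* n)
    lemma m n le rewrite ℕ.*-identityˡ n | ℕ.*-identityˡ (n ℕ.* n) = begin
      (n ℕ.+ n) ℕ.* m           ≡⟨ ℕ.*-distribʳ-+ m n n ⟩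
      n ℕ.* m ℕ.+ n ℕ.* m       ≡⟨ sym (ℕ.*-distribˡ-+ n m m) ⟩
      n ℕ.* (m ℕ.+ m)           ≡⟨ cong (λ t → n ℕ.* (m ℕ.+ t)) (sym (ℕ.+-identityʳ m)) ⟩
      n ℕ.* (2 ℕ.* m)           ≤⟨ ℕ.*-monoʳ-≤ n le ⟩
      n ℕ.* n                   ∎
      where open ℕ.≤-Reasoning

  expSum-bound : ∀ m → expSum (suc m) ℚ.+ invFact (suc m) ℚ.≤ + 3 / 1
  expSum-bound zero    = ℚ.≤-refl
  expSum-bound (suc m) =
    ℚ.≤-reflexive (ℚ.+-assoc (expSum (suc m)) (invFact (2 ℕ.+ m)) (invFact (2 ℕ.+ m)))
    ≤⟨⟩ ℚ.+-monoʳ-≤ (expSum (suc m))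
          (half (suc m !) ((2 ℕ.+ m) !) {{suc m ℕ.!≢0}} {{(2 ℕ.+ m) ℕ.!≢0}}
            (ℕ.*-monoˡ-≤ (suc m !) {2} {2 ℕ.+ m} (ℕ.s≤s (ℕ.s≤s ℕ.z≤n))))
    ≤⟨⟩ expSum-bound m

  0≤invFact : ∀ m → 0ℚ ℚ.≤ invFact m
  0≤invFact m = ℚ.nonNegative⁻¹ (invFact m) {{ℚ.normalize-nonNeg 1 (m !) {{m ℕ.!≢0}}}}

  grow : ∀ a {b} → 0ℚ ℚ.≤ b → a ℚ.≤ a ℚ.+ b
  grow a 0≤b = subst (ℚ._≤ a ℚ.+ _) (ℚ.+-identityʳ a) (ℚ.+-monoʳ-≤ a 0≤b)

e : ℝ
e = sup (λ u → ∃ λ m → u ≡ expSum m) (_ , 0 , refl)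
  (+ 3 / 1 , λ { (m , refl) →
     grow (expSum m) (0≤invFact (suc m))
     ≤⟨⟩ grow (expSum (suc m)) (0≤invFact (suc m)) ≤⟨⟩ expSum-bound m })

1≤e : 1ℝ ≤ e
1≤e (u , refl , q<1) = 1ℚ , (0 , refl) , q<1

e^_ : ℝ → ℝ
e^ x = pow e 1≤e x

SetFunction : ℕ → Set₁
SetFunction n = Subset n → ℝ

module _ {n : ℕ} where

  Monotone : SetFunction n → Set
  Monotone f = ∀ S T → S ⊆ T → f S ≤ f T

  Submodular : SetFunction n → Set
  Submodular f = ∀ S T → f (S ∪ T) ≤ f S + f T - f (S ∩ T)

  Erroneous : ℝ → SetFunction n → SetFunction n → Set
  Erroneous ε f f̃ = ∀ S → (1ℝ - ε) * f S ≤ f̃ S × f̃ S ≤ (1ℝ + ε) * f S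

private
  allBounded : ∀ {n} (g : Subset n → ℚ) → ∃ λ M → ∀ S → g S ℚ.≤ M
  allBounded {zero}  g = g [] , λ { [] → ℚ.≤-refl }
  allBounded {suc n} g with allBounded (λ S → g (true ∷ S)) | allBounded (λ S → g (false ∷ S))
  ... | M , g≤M | M′ , g≤M′ = M ℚ.⊔ M′ , λ
    { (true  ∷ S) → g≤M S  ≤⟨⟩ ℚ.p≤p⊔q M M′
    ; (false ∷ S) → g≤M′ S ≤⟨⟩ ℚ.p≤q⊔p M M′ }

-- max { f T : ∣ T ∣ ≤ k }; the maximum of finitely many cuts is their union.
maxValue : ∀ {n} → SetFunction n → ℕ → ℝ
maxValue {n} f k = sup
  (λ u → ∃ λ T → ∣ T ∣ ℕ.≤ k × f T ∋ u)
  (let (u , f∋u) = ℝ.inhabited (f Subset.⊥) in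
   u , Subset.⊥ , subst (ℕ._≤ k) (sym (∣⊥∣≡0 n)) ℕ.z≤n , f∋u)
  (let (M , b≤M) = allBounded (λ T → proj₁ (ℝ.proper (f T))) in
   M , λ (T , _ , f∋u) → below≤above (f T) f∋u (proj₂ (ℝ.proper (f T))) ≤⟨⟩ b≤M T)

-- Returning an infeasible set counts as a failure.
Approximates : ∀ {n} → SetFunction n → ℕ → ℝ → Subset n → Set
Approximates f k α S = ∣ S ∣ ℕ.≤ k × α * maxValue f k ≤ f S

-- Adaptive randomized algorithms that output a subset of Fin n after at
-- most q oracle queries.  The next step after a query is an arbitrary
-- function of the answer; toss m continues with a uniformly random
-- element of Fin m.  Computation between queries is unrestricted.
data Algorithm (n : ℕ) : ℕ → Set₁ where
  output : ∀ {q} → Subset n → Algorithm n q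
  query  : ∀ {q} → Subset n → (ℝ → Algorithm n q) → Algorithm n (suc q)
  toss   : ∀ {q} (m : ℕ) .{{_ : ℕ.NonZero m}} → (Fin m → Algorithm n q) → Algorithm n q

-- ProbAtLeast f̃ E A r: run with the oracle f̃, the algorithm A outputs a
-- set satisfying E with probability at least r.  (A lower bound rather
-- than the probability itself, as E need not be decidable.)
ProbAtLeast : ∀ {n q} → SetFunction n → (Subset n → Set) → Algorithm n q → ℚ → Set
ProbAtLeast f̃ E (output S)  r = (E S × r ℚ.≤ 1ℚ) ⊎ r ℚ.≤ 0ℚ
ProbAtLeast f̃ E (query S g) r = ProbAtLeast f̃ E (g (f̃ S)) r
ProbAtLeast f̃ E (toss m g)  r =
  Σ (Fin m → ℚ) λ w → (∀ i → ProbAtLeast f̃ E (g i) (w i)) × r ℚ.≤ + 1 / m ℚ.* sumℚ w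

-- The algorithm is given the cardinality bound k and an ε-erroneous
-- oracle; on every instance it finds an α-approximate solution with
-- probability at least p.
ObtainsApproximation : ∀ {n q} → (ℕ → Algorithm n q) → (ε α : ℝ) → (p : ℚ) → Set₁
ObtainsApproximation {n} A ε α p =
  ∀ (f : SetFunction n) → Monotone f → Submodular f →
  ∀ (f̃ : SetFunction n) → Erroneous ε f f̃ →
  ∀ (k : ℕ) → ProbAtLeast f̃ (Approximates f k α) (A k) p

-- Draw x ∈ (Fin n)^k uniformly with k ≈ √n, let hits x S be the number of coordinates of x that lie in S,
-- and let f x S = n · hits x S + A · base S, where base S = n (t + 2) + 2 k |S|, 1 / (A + 1) < ε and t ≈ 2 n^δ.
-- This is modular up to a constant, and its maximum over |S| ≤ k is at least n k, attained on the
-- coordinates of x.  Call S typical for x if n · hits x S ≤ base S: then A · base S, which does not depend on x,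
-- is within a factor 1 - ε of f x S, so an ε-erroneous oracle may answer A · base S on typical sets, and a
-- typical S with |S| ≤ k has value O(n t), which is O(n k) · n^(-1/2+δ).  By a Chernoff bound each fixed S is atypical
-- with probability at most 2^-t over x.  Hence an algorithm asking q queries succeeds with probability at
-- most (q + 1) 2^-t on average over x, and t is chosen such that this tends to 0 for q ≤ e^(n^δ) / n.

module Submission where

open import Defs
open import Algebra.Bundles using (CommutativeRing)
import Algebra.Properties.CommutativeMonoid.Sum as CommutativeMonoidSum
import Algebra.Properties.CommutativeSemiring.Exp as CommutativeExp
open import Algebra.Properties.CommutativeSemigroup using (interchange)
import Algebra.Properties.Monoid.Sum as MonoidSum
import Algebra.Properties.Semiring.Sum as SemiringSum
open import Data.Bool.Base using (Bool; true; false; _∨_; _∧_; if_then_else_)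
open import Data.Fin.Base as Fin using (Fin)
open import Data.Fin.Subset as Subset using (Subset; _⊆_; _∪_; _∩_; ∣_∣; ⁅_⁆)
import Data.Fin.Subset.Properties as Subset
open import Data.Integer.Base as ℤ using (+_; -[1+_])
import Data.Integer.Properties as ℤ
open import Data.Integer.Tactic.RingSolver using () renaming (solve-∀ to solve-∀ℤ)
open import Data.Nat.Base as ℕ using (ℕ; zero; suc)
import Data.Nat.Coprimality as Coprime
import Data.Nat.DivMod as ℕ
import Data.Nat.Properties as ℕ
open import Data.Nat.Tactic.RingSolver using () renaming (solve-∀ to solve-∀ℕ)
open import Data.Product using (∃; _×_; _,_; proj₁; proj₂)
open import Data.Rational as ℚ using (ℚ; mkℚ; 0ℚ; 1ℚ; ½; _/_; ↥_; ↧ₙ_)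
import Data.Rational.Properties as ℚ
open import Data.Rational.Unnormalised as ℚᵘ using (mkℚᵘ)
import Data.Rational.Unnormalised.Properties as ℚᵘ
open import Data.Sum.Base using (inj₁; inj₂)
open import Data.Vec.Base using (Vec; []; _∷_; lookup)
import Data.Vec.Properties as Vec
open import Function.Base using (it)
open import Relation.Binary.PropositionalEquality using (_≡_; refl; sym; trans; cong; cong₂; subst; module ≡-Reasoning)
open import Relation.Nullary using (Dec; ¬_; yes; no; contradiction; dec⇒maybe)
open import Tactic.RingSolver using (solve-∀)
open import Tactic.RingSolver.Core.AlmostCommutativeRing using (AlmostCommutativeRing; fromCommutativeRing)

-- Naturals in the rationals, and ordered-field lemmas

ringℚ : AlmostCommutativeRing _ _
ringℚ = fromCommutativeRing ℚ.+-*-commutativeRing (λ p → dec⇒maybe (0ℚ ℚ.≟ p))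

module ℚ^ = CommutativeExp (CommutativeRing.commutativeSemiring ℚ.+-*-commutativeRing)

-- Opacity keeps conversion checking from normalising fractions; the equations of this block serve
-- as the interface to `ι`.
opaque
  ι : ℕ → ℚ
  ι n = + n / 1

  ι≡/1 : ∀ n → ι n ≡ + n / 1
  ι≡/1 n = refl

  ι-0 : ι 0 ≡ 0ℚ
  ι-0 = refl

  ι-1 : ι 1 ≡ 1ℚ
  ι-1 = refl

  ι-toℚᵘ : ∀ n → ℚ.toℚᵘ (ι n) ℚᵘ.≃ mkℚᵘ (+ n) 0
  ι-toℚᵘ n = ℚ.toℚᵘ-fromℚᵘ (mkℚᵘ (+ n) 0)

ι-homo-+ : ∀ m n → ι (m ℕ.+ n) ≡ ι m ℚ.+ ι n
ι-homo-+ m n = ℚ.toℚᵘ-injective (begin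
  ℚ.toℚᵘ (ι (m ℕ.+ n))                   ≈⟨ ι-toℚᵘ (m ℕ.+ n) ⟩
  mkℚᵘ (+ (m ℕ.+ n)) 0                   ≈⟨ ℚᵘ.*≡* (cong (ℤ._* + 1) (trans (ℤ.pos-+ m n)
                                               (sym (cong₂ ℤ._+_ (ℤ.*-identityʳ (+ m)) (ℤ.*-identityʳ (+ n)))))) ⟩
  mkℚᵘ (+ m) 0 ℚᵘ.+ mkℚᵘ (+ n) 0         ≈⟨ ℚᵘ.+-cong (ℚᵘ.≃-sym (ι-toℚᵘ m)) (ℚᵘ.≃-sym (ι-toℚᵘ n)) ⟩
  ℚ.toℚᵘ (ι m) ℚᵘ.+ ℚ.toℚᵘ (ι n)         ≈⟨ ℚᵘ.≃-sym (ℚ.toℚᵘ-homo-+ (ι m) (ι n)) ⟩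
  ℚ.toℚᵘ (ι m ℚ.+ ι n)                   ∎)
  where open ℚᵘ.≃-Reasoning

ι-homo-* : ∀ m n → ι (m ℕ.* n) ≡ ι m ℚ.* ι n
ι-homo-* m n = ℚ.toℚᵘ-injective (begin
  ℚ.toℚᵘ (ι (m ℕ.* n))                   ≈⟨ ι-toℚᵘ (m ℕ.* n) ⟩
  mkℚᵘ (+ (m ℕ.* n)) 0                   ≈⟨ ℚᵘ.*≡* (cong (ℤ._* + 1) (ℤ.pos-* m n)) ⟩
  mkℚᵘ (+ m) 0 ℚᵘ.* mkℚᵘ (+ n) 0         ≈⟨ ℚᵘ.*-cong (ℚᵘ.≃-sym (ι-toℚᵘ m)) (ℚᵘ.≃-sym (ι-toℚᵘ n)) ⟩
  ℚ.toℚᵘ (ι m) ℚᵘ.* ℚ.toℚᵘ (ι n)         ≈⟨ ℚᵘ.≃-sym (ℚ.toℚᵘ-homo-* (ι m) (ι n)) ⟩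
  ℚ.toℚᵘ (ι m ℚ.* ι n)                   ∎)
  where open ℚᵘ.≃-Reasoning

ι-homo-^ : ∀ m n → ι (m ℕ.^ n) ≡ ι m ^ℚ n
ι-homo-^ m zero    = ι-1
ι-homo-^ m (suc n) = trans (ι-homo-* m (m ℕ.^ n)) (cong (ι m ℚ.*_) (ι-homo-^ m n))

ι-mono-≤ : ∀ {m n} → m ℕ.≤ n → ι m ℚ.≤ ι n
ι-mono-≤ {m} {n} m≤n = ℚ.toℚᵘ-cancel-≤
  (ℚᵘ.≤-respʳ-≃ (ℚᵘ.≃-sym (ι-toℚᵘ n)) (ℚᵘ.≤-respˡ-≃ (ℚᵘ.≃-sym (ι-toℚᵘ m))
    (ℚᵘ.*≤* (ℤ.*-monoʳ-≤-nonNeg (+ 1) (ℤ.+≤+ m≤n)))))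

ι-mono-< : ∀ {m n} → m ℕ.< n → ι m ℚ.< ι n
ι-mono-< {m} {n} m<n = ℚ.toℚᵘ-cancel-<
  (ℚᵘ.<-respʳ-≃ (ℚᵘ.≃-sym (ι-toℚᵘ n)) (ℚᵘ.<-respˡ-≃ (ℚᵘ.≃-sym (ι-toℚᵘ m))
    (ℚᵘ.*<* (ℤ.*-monoʳ-<-pos (+ 1) (ℤ.+<+ m<n)))))

ι-cancel-≤ : ∀ {m n} → ι m ℚ.≤ ι n → m ℕ.≤ n
ι-cancel-≤ {m} {n} ιm≤ιn with m ℕ.≤? n
... | yes m≤n = m≤n
... | no  m≰n = contradiction (ℚ.<-≤-trans (ι-mono-< (ℕ.≰⇒> m≰n)) ιm≤ιn) (ℚ.<-irrefl refl)

0≤1ℚ : 0ℚ ℚ.≤ 1ℚ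
0≤1ℚ = ℚ.nonNegative⁻¹ 1ℚ

0≤ι : ∀ n → 0ℚ ℚ.≤ ι n
0≤ι n = subst (ℚ._≤ ι n) ι-0 (ι-mono-≤ ℕ.z≤n)

0<ι : ∀ n .{{_ : ℕ.NonZero n}} → 0ℚ ℚ.< ι n
0<ι n = subst (ℚ._< ι n) ι-0 (ι-mono-< (ℕ.>-nonZero⁻¹ n))

*-monoˡ-≤ : ∀ {p q} r → 0ℚ ℚ.≤ r → p ℚ.≤ q → r ℚ.* p ℚ.≤ r ℚ.* q
*-monoˡ-≤ r 0≤r = ℚ.*-monoˡ-≤-nonNeg r {{ℚ.nonNegative 0≤r}}

*-monoʳ-≤ : ∀ {p q} r → 0ℚ ℚ.≤ r → p ℚ.≤ q → p ℚ.* r ℚ.≤ q ℚ.* r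
*-monoʳ-≤ r 0≤r = ℚ.*-monoʳ-≤-nonNeg r {{ℚ.nonNegative 0≤r}}

*-mono-≤ : ∀ {p q r s} → 0ℚ ℚ.≤ p → 0ℚ ℚ.≤ s → p ℚ.≤ q → r ℚ.≤ s → p ℚ.* r ℚ.≤ q ℚ.* s
*-mono-≤ {p} {s = s} 0≤p 0≤s p≤q r≤s = ℚ.≤-trans (*-monoˡ-≤ p 0≤p r≤s) (*-monoʳ-≤ s 0≤s p≤q)

*-monoˡ-< : ∀ {p q} r → 0ℚ ℚ.< r → p ℚ.< q → r ℚ.* p ℚ.< r ℚ.* q
*-monoˡ-< r 0<r = ℚ.*-monoʳ-<-pos r {{ℚ.positive 0<r}}

*-monoʳ-< : ∀ {p q} r → 0ℚ ℚ.< r → p ℚ.< q → p ℚ.* r ℚ.< q ℚ.* r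
*-monoʳ-< r 0<r = ℚ.*-monoˡ-<-pos r {{ℚ.positive 0<r}}

*-cancelˡ-≤ : ∀ {p q} r → 0ℚ ℚ.< r → r ℚ.* p ℚ.≤ r ℚ.* q → p ℚ.≤ q
*-cancelˡ-≤ r 0<r = ℚ.*-cancelˡ-≤-pos r {{ℚ.positive 0<r}}

*-nonNeg : ∀ {p q} → 0ℚ ℚ.≤ p → 0ℚ ℚ.≤ q → 0ℚ ℚ.≤ p ℚ.* q
*-nonNeg {p} {q} 0≤p 0≤q = subst (ℚ._≤ p ℚ.* q) (ℚ.*-zeroʳ p) (*-monoˡ-≤ p 0≤p 0≤q)

^-nonNeg : ∀ {p} n → 0ℚ ℚ.≤ p → 0ℚ ℚ.≤ p ^ℚ n
^-nonNeg zero    0≤p = 0≤1ℚ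
^-nonNeg (suc n) 0≤p = *-nonNeg 0≤p (^-nonNeg n 0≤p)

^-monoˡ-≤ : ∀ {p q} n → 0ℚ ℚ.≤ p → p ℚ.≤ q → p ^ℚ n ℚ.≤ q ^ℚ n
^-monoˡ-≤ zero    0≤p p≤q = ℚ.≤-refl
^-monoˡ-≤ (suc n) 0≤p p≤q =
  *-mono-≤ 0≤p (^-nonNeg n (ℚ.≤-trans 0≤p p≤q)) p≤q (^-monoˡ-≤ n 0≤p p≤q)

1^ : ∀ n → 1ℚ ^ℚ n ≡ 1ℚ
1^ zero    = refl
1^ (suc n) = trans (ℚ.*-identityˡ (1ℚ ^ℚ n)) (1^ n)

1≤^ : ∀ {p} n → 1ℚ ℚ.≤ p → 1ℚ ℚ.≤ p ^ℚ n
1≤^ {p} n 1≤p = subst (ℚ._≤ p ^ℚ n) (1^ n) (^-monoˡ-≤ n 0≤1ℚ 1≤p)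

≤-^ : ∀ {p} n → 1ℚ ℚ.≤ p → p ℚ.≤ p ^ℚ suc n
≤-^ {p} n 1≤p = subst (ℚ._≤ p ^ℚ suc n) (ℚ.*-identityʳ p) (*-monoˡ-≤ p (ℚ.≤-trans 0≤1ℚ 1≤p) (1≤^ n 1≤p))

1<^ : ∀ {p} n → 1ℚ ℚ.< p → 1ℚ ℚ.< p ^ℚ suc n
1<^ n 1<p = ℚ.<-≤-trans 1<p (≤-^ n (ℚ.<⇒≤ 1<p))

^-suc-≤1 : ∀ {p} n → p ^ℚ suc n ℚ.≤ 1ℚ → p ℚ.≤ 1ℚ
^-suc-≤1 {p} n p^≤1 with p ℚ.≤? 1ℚ
... | yes p≤1 = p≤1
... | no  p≰1 = contradiction (ℚ.<-≤-trans (1<^ n (ℚ.≰⇒> p≰1)) p^≤1) (ℚ.<-irrefl refl)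

-- Arithmetic of cuts

<+⇒-< : ∀ {p} q r → p ℚ.< q ℚ.+ r → p ℚ.- r ℚ.< q
<+⇒-< {p} q r p<q+r = subst (p ℚ.- r ℚ.<_) (identity q r) (ℚ.+-monoˡ-< (ℚ.- r) p<q+r)
  where
  identity : ∀ q r → q ℚ.+ r ℚ.- r ≡ q
  identity = solve-∀ ringℚ

-<⇒<+ : ∀ {p} q r → p ℚ.- r ℚ.< q → p ℚ.< q ℚ.+ r
-<⇒<+ {p} q r p-r<q = subst (ℚ._< q ℚ.+ r) (identity p r) (ℚ.+-monoˡ-< r p-r<q)
  where
  identity : ∀ p r → p ℚ.- r ℚ.+ r ≡ p
  identity = solve-∀ ringℚ

-- Density moves the slack of a strict inequality into one summand. This supplies the strictly
-- smaller witnesses that membership in a sum of cuts asks for.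
<+⇒∃<ˡ : ∀ {p} q r → p ℚ.< q ℚ.+ r → ∃ λ q′ → q′ ℚ.< q × p ℚ.< q′ ℚ.+ r
<+⇒∃<ˡ q r p<q+r =
  let (q′ , p-r<q′ , q′<q) = ℚ.<-dense (<+⇒-< q r p<q+r) in q′ , q′<q , -<⇒<+ q′ r p-r<q′

<+⇒∃<ʳ : ∀ {p} q r → p ℚ.< q ℚ.+ r → ∃ λ r′ → r′ ℚ.< r × p ℚ.< q ℚ.+ r′
<+⇒∃<ʳ {p} q r p<q+r =
  let (r′ , r′<r , p<r′+q) = <+⇒∃<ˡ r q (subst (p ℚ.<_) (ℚ.+-comm q r) p<q+r)
  in r′ , r′<r , subst (p ℚ.<_) (ℚ.+-comm r′ q) p<r′+q

fromℚ-∋ : ∀ {q r} → q ℚ.< r → fromℚ r ∋ q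
fromℚ-∋ {r = r} q<r = r , refl , q<r

fromℚ-∋⁻¹ : ∀ {q r} → fromℚ r ∋ q → q ℚ.< r
fromℚ-∋⁻¹ (_ , refl , q<r) = q<r

fromℕ-∋ : ∀ {q} n → q ℚ.< ι n → fromℕ n ∋ q
fromℕ-∋ {q} n q<n = fromℚ-∋ (subst (q ℚ.<_) (ι≡/1 n) q<n)

fromℕ-∋⁻¹ : ∀ {q} n → fromℕ n ∋ q → q ℚ.< ι n
fromℕ-∋⁻¹ {q} n n∋q = subst (q ℚ.<_) (sym (ι≡/1 n)) (fromℚ-∋⁻¹ n∋q)

0ℝ<⇒∋0 : ∀ {x} → 0ℝ < x → x ∋ 0ℚ
0ℝ<⇒∋0 {x} (q , 0∌q , x∋q) = ℝ.down x (ℚ.≮⇒≥ λ q<0 → 0∌q (fromℚ-∋ q<0)) x∋q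

+-∋ : ∀ x y {a b q} → x ∋ a → y ∋ b → q ℚ.< a ℚ.+ b → x + y ∋ q
+-∋ x y {a} {b} x∋a y∋b q<a+b = a ℚ.+ b , (a , b , x∋a , y∋b , refl) , q<a+b

neg-∋ : ∀ x {r q} → x ∌ r → q ℚ.< ℚ.- r → - x ∋ q
neg-∋ x {r} x∌r q<-r = ℚ.- r , (r , x∌r , refl) , q<-r

-- With nonnegative lower ends, `a * b` is the least of the four corner products, whatever upper
-- ends `proper` provides.
*-∋ : ∀ x y {a b q} → x ∋ a → y ∋ b → 0ℚ ℚ.≤ a → 0ℚ ℚ.≤ b → q ℚ.< a ℚ.* b → x * y ∋ q
*-∋ x y {a} {b} x∋a y∋b 0≤a 0≤b q<ab with ℝ.proper x | ℝ.proper y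
... | a′ , x∌a′ | b′ , y∌b′ = a ℚ.* b ,
  (a , a′ , b , b′ , x∋a , x∌a′ , y∋b , y∌b′ ,
   ℚ.≤-refl , *-monoˡ-≤ a 0≤a b≤b′ , *-monoʳ-≤ b 0≤b a≤a′ , *-mono-≤ 0≤a (ℚ.≤-trans 0≤b b≤b′) a≤a′ b≤b′) ,
  q<ab
  where
  a≤a′ = below≤above x x∋a x∌a′
  b≤b′ = below≤above y y∋b y∌b′

-- Since `c ≤ r ≤ d`, the value `a * r` lies between the corners `a * c` and `a * d`, so `u ≤ a * r`
-- for either sign of `a`; then `a ≤ s` finishes.
*-fromℚ-∋⁻¹ : ∀ x {r s q} → x ∌ s → 0ℚ ℚ.≤ r → x * fromℚ r ∋ q → q ℚ.< s ℚ.* r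
*-fromℚ-∋⁻¹ x {r} {s} x∌s 0≤r (u , (a , b , c , d , x∋a , _ , r∋c , r∌d , u≤ac , u≤ad , _) , q<u) =
  ℚ.<-≤-trans q<u (ℚ.≤-trans u≤ar (*-monoʳ-≤ r 0≤r (below≤above x x∋a x∌s)))
  where
  c≤r : c ℚ.≤ r
  c≤r = ℚ.<⇒≤ (fromℚ-∋⁻¹ r∋c)
  r≤d : r ℚ.≤ d
  r≤d = ℚ.≮⇒≥ λ d<r → r∌d (fromℚ-∋ d<r)
  u≤ar : u ℚ.≤ a ℚ.* r
  u≤ar with ℚ.≤-total 0ℚ a
  ... | inj₁ 0≤a = ℚ.≤-trans u≤ac (*-monoˡ-≤ a 0≤a c≤r)
  ... | inj₂ a≤0 = ℚ.≤-trans u≤ad (ℚ.*-monoˡ-≤-nonPos a {{ℚ.nonPositive a≤0}} r≤d)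

fromℕ-mono-≤ : ∀ {m n} → m ℕ.≤ n → fromℕ m ≤ fromℕ n
fromℕ-mono-≤ {m} {n} m≤n m∋q = fromℕ-∋ n (ℚ.<-≤-trans (fromℕ-∋⁻¹ m m∋q) (ι-mono-≤ m≤n))

fromℚ-≤-+ : ∀ x y {a b} → fromℚ a ≤ x → fromℚ b ≤ y → fromℚ (a ℚ.+ b) ≤ x + y
fromℚ-≤-+ x y {a} {b} a≤x b≤y a+b∋q =
  let (a′ , a′<a , q<a′+b)  = <+⇒∃<ˡ a b (fromℚ-∋⁻¹ a+b∋q)
      (b′ , b′<b , q<a′+b′) = <+⇒∃<ʳ a′ b q<a′+b
  in +-∋ x y (a≤x (fromℚ-∋ a′<a)) (b≤y (fromℚ-∋ b′<b)) q<a′+b′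

fromℚ-≤-neg : ∀ {a} → fromℚ (ℚ.- a) ≤ - fromℚ a
fromℚ-≤-neg {a} -a∋q = neg-∋ (fromℚ a) (λ a∋a → ℚ.<-irrefl refl (fromℚ-∋⁻¹ a∋a)) (fromℚ-∋⁻¹ -a∋q)

-- Reduces submodularity of a natural-valued function to an inequality free of subtraction.
fromℕ-≤-+- : ∀ a b c d → a ℕ.+ d ℕ.≤ b ℕ.+ c → fromℕ a ≤ fromℕ b + fromℕ c - fromℕ d
fromℕ-≤-+- a b c d a+d≤b+c a∋q =
  fromℚ-≤-+ (fromℕ b + fromℕ c) (- fromℕ d)
    (fromℚ-≤-+ (fromℕ b) (fromℕ c) (λ b∋p → b∋p) (λ c∋p → c∋p)) fromℚ-≤-neg
    (fromℚ-∋ (ℚ.<-≤-trans (fromℕ-∋⁻¹ a a∋q) a≤b+c-d))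
  where
  identity : ∀ p q → p ℚ.+ q ℚ.- q ≡ p
  identity = solve-∀ ringℚ
  a≤b+c-d : ι a ℚ.≤ + b / 1 ℚ.+ + c / 1 ℚ.- + d / 1
  a≤b+c-d rewrite sym (ι≡/1 b) | sym (ι≡/1 c) | sym (ι≡/1 d) =
    subst (ℚ._≤ ι b ℚ.+ ι c ℚ.- ι d) (trans (cong (ℚ._- ι d) (ι-homo-+ a d)) (identity (ι a) (ι d)))
      (ℚ.+-monoˡ-≤ (ℚ.- ι d) (subst (ι (a ℕ.+ d) ℚ.≤_) (ι-homo-+ b c) (ι-mono-≤ a+d≤b+c)))

1-ε∌1-e : ∀ ε {e} → ε ∋ e → 1ℝ - ε ∌ 1ℚ ℚ.- e
1-ε∌1-e ε {e} ε∋e (_ , (a , b , 1∋a , (_ , (r , ε∌r , refl) , b<-r) , refl) , 1-e<a+b) =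
  ℚ.<-irrefl refl (ℚ.<-trans 1-e<a+b (ℚ.+-mono-< (fromℚ-∋⁻¹ 1∋a)
    (ℚ.<-≤-trans b<-r (ℚ.neg-antimono-≤ (below≤above ε ε∋e ε∌r)))))

1+ε∋1 : ∀ {ε} → 0ℝ < ε → 1ℝ + ε ∋ 1ℚ
1+ε∋1 {ε} 0<ε =
  let (e , 0<e , ε∋e) = ℝ.rounded ε (0ℝ<⇒∋0 {ε} 0<ε)
      (a , a<1 , 1<a+e) = <+⇒∃<ˡ 1ℚ e (subst (ℚ._< 1ℚ ℚ.+ e) (ℚ.+-identityʳ 1ℚ) (ℚ.+-monoʳ-< 1ℚ 0<e))
  in +-∋ 1ℝ ε (fromℚ-∋ a<1) ε∋e 1<a+e

≤-Erroneous : ∀ ε {e} v w → ε ∋ e → (1ℚ ℚ.- e) ℚ.* ι v ℚ.≤ ι w → (1ℝ - ε) * fromℕ v ≤ fromℕ w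
≤-Erroneous ε {e} v w ε∋e le {q} v∋q = fromℕ-∋ w (ℚ.<-≤-trans
  (subst (λ r → q ℚ.< (1ℚ ℚ.- e) ℚ.* r) (sym (ι≡/1 v))
    (*-fromℚ-∋⁻¹ (1ℝ - ε) (1-ε∌1-e ε ε∋e) (subst (0ℚ ℚ.≤_) (ι≡/1 v) (0≤ι v)) v∋q)) le)

Erroneous-≤ : ∀ {ε} v .{{_ : ℕ.NonZero v}} w → 0ℝ < ε → w ℕ.≤ v → fromℕ w ≤ (1ℝ + ε) * fromℕ v
Erroneous-≤ {ε} v w 0<ε w≤v {q} w∋q =
  -- Taking `r` above both `q` and 0 makes it nonnegative, as `*-∋` asks, and still gives
  -- `q < 1 * r`; there is room for `r` because `v` is positive.
  let (r , m<r , r<v) = ℚ.<-dense q⊔0<v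
  in *-∋ (1ℝ + ε) (fromℕ v) (1+ε∋1 {ε} 0<ε) (fromℕ-∋ v r<v) 0≤1ℚ
       (ℚ.<⇒≤ (ℚ.≤-<-trans (ℚ.p≤q⊔p q 0ℚ) m<r))
       (subst (q ℚ.<_) (sym (ℚ.*-identityˡ r)) (ℚ.≤-<-trans (ℚ.p≤p⊔q q 0ℚ) m<r))
  where
  q<v : q ℚ.< ι v
  q<v = ℚ.<-≤-trans (fromℕ-∋⁻¹ w w∋q) (ι-mono-≤ w≤v)
  q⊔0<v : q ℚ.⊔ 0ℚ ℚ.< ι v
  q⊔0<v with ℚ.⊔-sel q 0ℚ
  ... | inj₁ q⊔0≡q = subst (ℚ._< ι v) (sym q⊔0≡q) q<v
  ... | inj₂ q⊔0≡0 = subst (ℚ._< ι v) (sym q⊔0≡0) (0<ι v)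

-- Powers of cuts

≤-reached : ∀ x {q} → x ∌ q → ∀ {p} → x ∋ p → p ℚ.< q
≤-reached x x∌q x∋p = let (r , p<r , x∋r) = ℝ.rounded x x∋p in ℚ.<-≤-trans p<r (below≤above x x∋r x∌q)

ι-mkℚ : ∀ n → ι n ≡ mkℚ (+ n) 0 (Coprime.sym (Coprime.1-coprimeTo n))
ι-mkℚ n = trans (ι≡/1 n) (ℚ.↥p/↧p≡p (mkℚ (+ n) 0 _))

-- At an integer exponent m the bound recorded in the definition of pow computes to 3 ^ m.
e^-∌ : ∀ x m → x ∌ ι m → e^ x ∌ (+ 3 / 1) ^ℚ m
e^-∌ x m x∌m (u , (0≤u , s , x∋s , bound) , 3^m<u) =
  proj₂ (ℝ.proper (e^ (fromℚ m′))) (u , (0≤u , s , fromℚ-∋ s<m , bound) , 3^m<u)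
  where
  m′ = mkℚ (+ m) 0 (Coprime.sym (Coprime.1-coprimeTo m))
  s<m : s ℚ.< m′
  s<m = subst (s ℚ.<_) (ι-mkℚ m) (≤-reached x x∌m x∋s)

-- The hypothesis says `J + 1 < n ^ (1 / d)` for the denominator `d` of `s`, and a positive `s` is
-- at least `1 / d`. Hence `n ^ x` exceeds any given constant once `n` is large.
^-∋-ι : ∀ n .{{_ : ℕ.NonZero n}} x s J → x ∋ s → 0ℚ ℚ.< s → suc J ℕ.^ ↧ₙ s ℕ.< n → n ^ x ∋ ι J
^-∋-ι n x s@(mkℚ (+ zero)  d _) J x∋s 0<s _ = contradiction (ℚ.drop-*<* 0<s) (ℤ.<-irrefl refl)
^-∋-ι n x s@(mkℚ -[1+ i ]  d _) J x∋s 0<s _ = contradiction (ℚ.drop-*<* 0<s) λ ()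
^-∋-ι n x s@(mkℚ (+ suc i) d _) J x∋s 0<s J^d<n =
  ι (suc J) ,
  (0≤ι (suc J) , s , x∋s , c , fromℕ-∋ n (ι-mono-< J^d<n) , 0≤ι _ ,
   ℚ.≤-trans (ℚ.≤-reflexive (sym (ι-homo-^ (suc J) (suc d)))) (≤-^ i 1≤c)) ,
  ι-mono-< (ℕ.n<1+n J)
  where
  c = ι (suc J ℕ.^ suc d)
  1≤c : 1ℚ ℚ.≤ c
  1≤c = subst (ℚ._≤ c) ι-1 (ι-mono-≤ (ℕ.m^n>0 (suc J) (suc d)))

-- The equation `s - ½ = t` times twice both denominators, with the negative terms moved across so
-- that it can serve as an identity between natural exponents.
-½-numerator : ∀ s t {i a} → s ℚ.- ½ ≡ t → ↥ s ≡ + i → ↥ t ≡ -[1+ a ] →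
  suc a ℕ.* (2 ℕ.* ↧ₙ s) ℕ.+ 2 ℕ.* i ℕ.* ↧ₙ t ≡ ↧ₙ s ℕ.* ↧ₙ t
-½-numerator s@(mkℚ (+ i) d-1 _) t@(mkℚ -[1+ a ] b-1 _) eq refl refl = ℤ.+-injective (begin
  + (suc a ℕ.* (2 ℕ.* d) ℕ.+ 2 ℕ.* i ℕ.* b)            ≡⟨ pos-expand ⟩
  A ℤ.* (+ 2 ℤ.* D) ℤ.+ + 2 ℤ.* I ℤ.* B                ≡⟨ identity₁ A I D B ⟩
  + 2 ℤ.* I ℤ.* B ℤ.- (ℤ.- A) ℤ.* (D ℤ.* + 2)          ≡⟨ cong (λ x → + 2 ℤ.* I ℤ.* B ℤ.- x) (sym cross) ⟩
  + 2 ℤ.* I ℤ.* B ℤ.- (I ℤ.* + 2 ℤ.+ (ℤ.- + 1) ℤ.* D) ℤ.* B ≡⟨ identity₂ I D B ⟩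
  D ℤ.* B                                              ≡⟨ sym (ℤ.pos-* d b) ⟩
  + (d ℕ.* b)                                          ∎)
  where
  open ≡-Reasoning
  d = suc d-1
  b = suc b-1
  A = + suc a
  I = + i
  D = + d
  B = + b
  -- In the unnormalised rationals the sum keeps the denominator `d * 2`, so equality there is
  -- exactly this cross multiplication.
  cross : (I ℤ.* + 2 ℤ.+ (ℤ.- + 1) ℤ.* D) ℤ.* B ≡ (ℤ.- A) ℤ.* (D ℤ.* + 2)
  cross with ℚᵘ.≃-trans (ℚᵘ.≃-sym (ℚ.toℚᵘ-homo-+ s (ℚ.- ½))) (ℚ.toℚᵘ-cong eq)
  ... | ℚᵘ.*≡* e = trans e (cong (ℤ.- A ℤ.*_) (ℤ.pos-* d 2))
  pos-expand : + (suc a ℕ.* (2 ℕ.* d) ℕ.+ 2 ℕ.* i ℕ.* b) ≡ A ℤ.* (+ 2 ℤ.* D) ℤ.+ + 2 ℤ.* I ℤ.* B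
  pos-expand = trans (ℤ.pos-+ (suc a ℕ.* (2 ℕ.* d)) (2 ℕ.* i ℕ.* b)) (cong₂ ℤ._+_
    (trans (ℤ.pos-* (suc a) (2 ℕ.* d)) (cong (A ℤ.*_) (ℤ.pos-* 2 d)))
    (trans (ℤ.pos-* (2 ℕ.* i) b) (cong (ℤ._* B) (ℤ.pos-* 2 i))))
  identity₁ : ∀ A I D B → A ℤ.* (+ 2 ℤ.* D) ℤ.+ + 2 ℤ.* I ℤ.* B ≡ + 2 ℤ.* I ℤ.* B ℤ.- (ℤ.- A) ℤ.* (D ℤ.* + 2)
  identity₁ = solve-∀ℤ
  identity₂ : ∀ I D B → + 2 ℤ.* I ℤ.* B ℤ.- (I ℤ.* + 2 ℤ.+ (ℤ.- + 1) ℤ.* D) ℤ.* B ≡ D ℤ.* B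
  identity₂ = solve-∀ℤ

-- u^d ≤ n^i and κ² n ≤ 1 give (u κ)^d ≤ n^(i - d/2); both sides are raised to the power 2 d b to
-- avoid the fractional exponent.
*-^-≤1 : ∀ {n u κ} i d a b .{{_ : ℕ.NonZero d}} →
  0ℚ ℚ.≤ u → 0ℚ ℚ.≤ n → 0ℚ ℚ.≤ κ →
  suc a ℕ.* (2 ℕ.* d) ℕ.+ 2 ℕ.* i ℕ.* b ≡ d ℕ.* b →
  u ^ℚ d ℚ.≤ n ^ℚ i → κ ℚ.* κ ℚ.* n ℚ.≤ 1ℚ → (u ℚ.* κ) ^ℚ b ℚ.* n ^ℚ suc a ℚ.≤ 1ℚ
*-^-≤1 {n} {u} {κ} i d@(suc d-1) a b 0≤u 0≤n 0≤κ exponents u^d≤n^i κκn≤1 =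
  ^-suc-≤1 (d-1 ℕ.+ suc (d-1 ℕ.+ 0)) (begin
  ((u ℚ.* κ) ^ℚ b ℚ.* n ^ℚ suc a) ^ℚ (2 ℕ.* d)
    ≡⟨ ℚ^.^-distrib-* ((u ℚ.* κ) ^ℚ b) (n ^ℚ suc a) (2 ℕ.* d) ⟩
  ((u ℚ.* κ) ^ℚ b) ^ℚ (2 ℕ.* d) ℚ.* (n ^ℚ suc a) ^ℚ (2 ℕ.* d)
    ≡⟨ cong₂ ℚ._*_ (trans (cong (_^ℚ (2 ℕ.* d)) (ℚ^.^-distrib-* u κ b))
         (ℚ^.^-distrib-* (u ^ℚ b) (κ ^ℚ b) (2 ℕ.* d))) (ℚ^.^-assocʳ n (suc a) (2 ℕ.* d)) ⟩
  (u ^ℚ b) ^ℚ (2 ℕ.* d) ℚ.* (κ ^ℚ b) ^ℚ (2 ℕ.* d) ℚ.* n ^ℚ (suc a ℕ.* (2 ℕ.* d))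
    ≤⟨ *-monoʳ-≤ _ (^-nonNeg (suc a ℕ.* (2 ℕ.* d)) 0≤n)
         (*-monoʳ-≤ _ (^-nonNeg (2 ℕ.* d) (^-nonNeg b 0≤κ)) u-part) ⟩
  n ^ℚ (2 ℕ.* i ℕ.* b) ℚ.* (κ ^ℚ b) ^ℚ (2 ℕ.* d) ℚ.* n ^ℚ (suc a ℕ.* (2 ℕ.* d))
    ≡⟨ identity (n ^ℚ (2 ℕ.* i ℕ.* b)) ((κ ^ℚ b) ^ℚ (2 ℕ.* d)) (n ^ℚ (suc a ℕ.* (2 ℕ.* d))) ⟩
  (κ ^ℚ b) ^ℚ (2 ℕ.* d) ℚ.* (n ^ℚ (suc a ℕ.* (2 ℕ.* d)) ℚ.* n ^ℚ (2 ℕ.* i ℕ.* b))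
    ≡⟨ cong₂ ℚ._*_ κ-part (trans (sym (ℚ^.^-homo-* n (suc a ℕ.* (2 ℕ.* d)) (2 ℕ.* i ℕ.* b))) (cong (n ^ℚ_) exponents)) ⟩
  (κ ℚ.* κ) ^ℚ (d ℕ.* b) ℚ.* n ^ℚ (d ℕ.* b)
    ≡⟨ sym (ℚ^.^-distrib-* (κ ℚ.* κ) n (d ℕ.* b)) ⟩
  (κ ℚ.* κ ℚ.* n) ^ℚ (d ℕ.* b)
    ≤⟨ ^-monoˡ-≤ (d ℕ.* b) (*-nonNeg (*-nonNeg 0≤κ 0≤κ) 0≤n) κκn≤1 ⟩
  1ℚ ^ℚ (d ℕ.* b)
    ≡⟨ 1^ (d ℕ.* b) ⟩
  1ℚ ∎)
  where
  open ℚ.≤-Reasoning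
  identity : ∀ p q r → p ℚ.* q ℚ.* r ≡ q ℚ.* (r ℚ.* p)
  identity = solve-∀ ringℚ
  exponent-u : ∀ b d → b ℕ.* (2 ℕ.* d) ≡ d ℕ.* (2 ℕ.* b)
  exponent-u = solve-∀ℕ
  exponent-n : ∀ i b → i ℕ.* (2 ℕ.* b) ≡ 2 ℕ.* i ℕ.* b
  exponent-n = solve-∀ℕ
  exponent-κ : ∀ b d → b ℕ.* (2 ℕ.* d) ≡ 2 ℕ.* (d ℕ.* b)
  exponent-κ = solve-∀ℕ
  u-part : (u ^ℚ b) ^ℚ (2 ℕ.* d) ℚ.≤ n ^ℚ (2 ℕ.* i ℕ.* b)
  u-part = begin
    (u ^ℚ b) ^ℚ (2 ℕ.* d)   ≡⟨ trans (ℚ^.^-assocʳ u b (2 ℕ.* d)) (cong (u ^ℚ_) (exponent-u b d)) ⟩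
    u ^ℚ (d ℕ.* (2 ℕ.* b))  ≡⟨ sym (ℚ^.^-assocʳ u d (2 ℕ.* b)) ⟩
    (u ^ℚ d) ^ℚ (2 ℕ.* b)   ≤⟨ ^-monoˡ-≤ (2 ℕ.* b) (^-nonNeg d 0≤u) u^d≤n^i ⟩
    (n ^ℚ i) ^ℚ (2 ℕ.* b)   ≡⟨ trans (ℚ^.^-assocʳ n i (2 ℕ.* b)) (cong (n ^ℚ_) (exponent-n i b)) ⟩
    n ^ℚ (2 ℕ.* i ℕ.* b)    ∎
  κ-part : (κ ^ℚ b) ^ℚ (2 ℕ.* d) ≡ (κ ℚ.* κ) ^ℚ (d ℕ.* b)
  κ-part = trans (ℚ^.^-assocʳ κ b (2 ℕ.* d)) (trans (cong (κ ^ℚ_) (exponent-κ b d))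
    (trans (sym (ℚ^.^-assocʳ κ 2 (d ℕ.* b))) (cong (λ x → (κ ℚ.* x) ^ℚ (d ℕ.* b)) (ℚ.*-identityʳ κ))))

-- Here `κ` is a rational lower bound of `n ^ (-1/2)`. Since `x < ½`, the exponent `s - ½` is
-- negative, so `PowerBound` takes its reciprocal form, with `n` itself as the upper bound of the
-- base.
^-½-∋ : ∀ n .{{_ : ℕ.NonZero n}} x j .{{_ : ℕ.NonZero j}} {κ} → x < ½ℝ →
  0ℚ ℚ.< κ → κ ℚ.* κ ℚ.* ι n ℚ.≤ 1ℚ → n ^ x ∋ ι j → n ^ (- ½ℝ + x) ∋ ι j ℚ.* κ
^-½-∋ n x j {κ} (h , x∌h , ½∋h) 0<κ κκn≤1 (u , (0≤u , s@(mkℚ (+ i) d-1 _) , x∋s , c , n∋c , 0≤c , u^d≤c^i) , j<u) =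
  u ℚ.* κ , (*-nonNeg 0≤u (ℚ.<⇒≤ 0<κ) , t , ∋t , bound t refl) , *-monoʳ-< κ 0<κ j<u
  where
  t = s ℚ.- ½
  t<0 : t ℚ.< 0ℚ
  t<0 = ℚ.+-monoˡ-< (ℚ.- ½) (ℚ.≤-<-trans (below≤above x x∋s x∌h) (fromℚ-∋⁻¹ ½∋h))
  ∋t : - ½ℝ + x ∋ t
  ∋t = let (s′ , s<s′ , x∋s′) = ℝ.rounded x x∋s
           (a , a<-½ , t<a+s′) = <+⇒∃<ˡ (ℚ.- ½) s′
             (subst (ℚ._< ℚ.- ½ ℚ.+ s′) (ℚ.+-comm (ℚ.- ½) s) (ℚ.+-monoʳ-< (ℚ.- ½) s<s′))
       in +-∋ (- ½ℝ) x (neg-∋ ½ℝ (λ ½∋½ → ℚ.<-irrefl refl (fromℚ-∋⁻¹ ½∋½)) a<-½) x∋s′ t<a+s′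
  -- The difference `s - ½` does not reduce to a constructor, so the case split is on a copy `t′`
  -- tied to it by an equation.
  bound : ∀ t′ → t ≡ t′ → PowerBound (fromℕ n) (u ℚ.* κ) (↥ t′) (↧ₙ t′)
  bound t′@(mkℚ (+ a) b-1 _) eq = 
    contradiction (ℚ.≤-<-trans (ℚ.nonNegative⁻¹ t′) (subst (ℚ._< 0ℚ) eq t<0)) (ℚ.<-irrefl refl)
  bound t′@(mkℚ -[1+ a ] b-1 _) eq = ι n , (λ n∋n → ℚ.<-irrefl refl (fromℕ-∋⁻¹ n n∋n)) ,
    *-^-≤1 i (suc d-1) a (suc b-1) 0≤u (0≤ι n) (ℚ.<⇒≤ 0<κ) (-½-numerator s t′ eq refl refl)
      (ℚ.≤-trans u^d≤c^i (^-monoˡ-≤ i 0≤c (ℚ.<⇒≤ (fromℕ-∋⁻¹ n n∋c)))) κκn≤1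
-- A negative `s` cannot occur: `u > j ≥ 1` and `c ≥ 1` push the product above 1.
^-½-∋ n x j x<½ 0<κ κκn≤1 (u , (0≤u , mkℚ -[1+ i ] d-1 _ , x∋s , c , n∌c , u^dc^i≤1) , j<u) =
  contradiction (ℚ.<-≤-trans 1<u^dc^i u^dc^i≤1) (ℚ.<-irrefl refl)
  where
  1≤ι : ∀ m .{{_ : ℕ.NonZero m}} → 1ℚ ℚ.≤ ι m
  1≤ι m = subst (ℚ._≤ ι m) ι-1 (ι-mono-≤ (ℕ.>-nonZero⁻¹ m))
  1≤c : 1ℚ ℚ.≤ c
  1≤c = ℚ.≤-trans (1≤ι n) (ℚ.≮⇒≥ λ c<n → n∌c (fromℕ-∋ n c<n))
  1<u^d : 1ℚ ℚ.< u ^ℚ suc d-1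
  1<u^d = 1<^ d-1 (ℚ.≤-<-trans (1≤ι j) j<u)
  1<u^dc^i : 1ℚ ℚ.< u ^ℚ suc d-1 ℚ.* c ^ℚ suc i
  1<u^dc^i = ℚ.<-≤-trans 1<u^d (subst (ℚ._≤ u ^ℚ suc d-1 ℚ.* c ^ℚ suc i) (ℚ.*-identityʳ _)
    (*-monoˡ-≤ _ (ℚ.≤-trans 0≤1ℚ (ℚ.<⇒≤ 1<u^d)) (1≤^ (suc i) 1≤c)))

-- Averages and hits

module ℚΣ where
  open CommutativeMonoidSum ℚ.+-0-commutativeMonoid public using (∑-distrib-+; ∑-comm)
  open MonoidSum ℚ.+-0-monoid public using (sum-cong-≗)
  open SemiringSum (CommutativeRing.semiring ℚ.+-*-commutativeRing) public using (*-distribˡ-sum)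

opaque
  ν : ∀ m .{{_ : ℕ.NonZero m}} → ℚ
  ν m = + 1 / m

  ν≡1/ : ∀ m .{{_ : ℕ.NonZero m}} → ν m ≡ + 1 / m
  ν≡1/ m = refl

  0≤ν : ∀ m .{{_ : ℕ.NonZero m}} → 0ℚ ℚ.≤ ν m
  0≤ν m = ℚ.nonNegative⁻¹ (ν m) {{ℚ.normalize-nonNeg 1 m}}

  0<ν : ∀ m .{{_ : ℕ.NonZero m}} → 0ℚ ℚ.< ν m
  0<ν m = ℚ.positive⁻¹ (ν m) {{ℚ.normalize-pos 1 m}}

  ν*ι : ∀ m .{{_ : ℕ.NonZero m}} → ν m ℚ.* ι m ≡ 1ℚ
  ν*ι m@(suc m-1) = ℚ.toℚᵘ-injective (begin
    ℚ.toℚᵘ (ν m ℚ.* ι m)                ≈⟨ ℚ.toℚᵘ-homo-* (ν m) (ι m) ⟩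
    ℚ.toℚᵘ (ν m) ℚᵘ.* ℚ.toℚᵘ (ι m)      ≈⟨ ℚᵘ.*-cong (ℚ.toℚᵘ-fromℚᵘ (mkℚᵘ (+ 1) m-1)) (ι-toℚᵘ m) ⟩
    mkℚᵘ (+ 1) m-1 ℚᵘ.* mkℚᵘ (+ m) 0    ≈⟨ ℚᵘ.*≡* (ℤ.*-assoc (+ 1) (+ m) (+ 1)) ⟩
    ℚ.toℚᵘ 1ℚ                           ∎)
    where open ℚᵘ.≃-Reasoning

ι≤ν⁻¹ : ∀ m .{{_ : ℕ.NonZero m}} {p} → ι m ℚ.* p ℚ.≤ 1ℚ → p ℚ.≤ ν m
ι≤ν⁻¹ m {p} mp≤1 = begin
  p                     ≡⟨ sym (trans (cong (ℚ._* p) (ν*ι m)) (ℚ.*-identityˡ p)) ⟩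
  ν m ℚ.* ι m ℚ.* p     ≡⟨ ℚ.*-assoc (ν m) (ι m) p ⟩
  ν m ℚ.* (ι m ℚ.* p)   ≤⟨ *-monoˡ-≤ (ν m) (0≤ν m) mp≤1 ⟩
  ν m ℚ.* 1ℚ            ≡⟨ ℚ.*-identityʳ (ν m) ⟩
  ν m                   ∎
  where open ℚ.≤-Reasoning

sum-mono : ∀ {m} {g h : Fin m → ℚ} → (∀ i → g i ℚ.≤ h i) → sumℚ g ℚ.≤ sumℚ h
sum-mono {zero}  g≤h = ℚ.≤-refl
sum-mono {suc m} g≤h = ℚ.+-mono-≤ (g≤h Fin.zero) (sum-mono λ i → g≤h (Fin.suc i))

sum-const : ∀ m p → sumℚ {m} (λ _ → p) ≡ ι m ℚ.* p
sum-const zero    p = sym (trans (cong (ℚ._* p) ι-0) (ℚ.*-zeroˡ p))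
sum-const (suc m) p = begin
  p ℚ.+ sumℚ {m} (λ _ → p)    ≡⟨ cong₂ ℚ._+_ (sym (ℚ.*-identityˡ p)) (sum-const m p) ⟩
  1ℚ ℚ.* p ℚ.+ ι m ℚ.* p      ≡⟨ sym (ℚ.*-distribʳ-+ p 1ℚ (ι m)) ⟩
  (1ℚ ℚ.+ ι m) ℚ.* p          ≡⟨ cong (λ x → (x ℚ.+ ι m) ℚ.* p) (sym ι-1) ⟩
  (ι 1 ℚ.+ ι m) ℚ.* p         ≡⟨ cong (ℚ._* p) (sym (ι-homo-+ 1 m)) ⟩
  ι (suc m) ℚ.* p             ∎
  where open ≡-Reasoning

module _ (m : ℕ) .{{_ : ℕ.NonZero m}} where

  avg : (Fin m → ℚ) → ℚ
  avg g = ν m ℚ.* sumℚ g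

  avg-cong : ∀ {g h} → (∀ i → g i ≡ h i) → avg g ≡ avg h
  avg-cong g≗h = cong (ν m ℚ.*_) (ℚΣ.sum-cong-≗ g≗h)

  avg-mono : ∀ {g h} → (∀ i → g i ℚ.≤ h i) → avg g ℚ.≤ avg h
  avg-mono g≤h = *-monoˡ-≤ (ν m) (0≤ν m) (sum-mono g≤h)

  avg-const : ∀ p → avg (λ _ → p) ≡ p
  avg-const p = trans (cong (ν m ℚ.*_) (sum-const m p))
    (trans (sym (ℚ.*-assoc (ν m) (ι m) p)) (trans (cong (ℚ._* p) (ν*ι m)) (ℚ.*-identityˡ p)))

  avg-+ : ∀ g h → avg (λ i → g i ℚ.+ h i) ≡ avg g ℚ.+ avg h
  avg-+ g h = trans (cong (ν m ℚ.*_) (ℚΣ.∑-distrib-+ g h)) (ℚ.*-distribˡ-+ (ν m) (sumℚ g) (sumℚ h))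

  avg-*ˡ : ∀ p g → avg (λ i → p ℚ.* g i) ≡ p ℚ.* avg g
  avg-*ˡ p g = trans (cong (ν m ℚ.*_) (sym (ℚΣ.*-distribˡ-sum p g))) (identity (ν m) p (sumℚ g))
    where
    identity : ∀ a b c → a ℚ.* (b ℚ.* c) ≡ b ℚ.* (a ℚ.* c)
    identity = solve-∀ ringℚ

avg-comm : ∀ m n .{{_ : ℕ.NonZero m}} .{{_ : ℕ.NonZero n}} (g : Fin m → Fin n → ℚ) →
  avg m (λ i → avg n (g i)) ≡ avg n (λ j → avg m (λ i → g i j))
avg-comm m n g = begin
  ν m ℚ.* sumℚ (λ i → ν n ℚ.* sumℚ (g i))         ≡⟨ cong (ν m ℚ.*_) (sym (ℚΣ.*-distribˡ-sum (ν n) λ i → sumℚ (g i))) ⟩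
  ν m ℚ.* (ν n ℚ.* sumℚ (λ i → sumℚ (g i)))       ≡⟨ cong (λ x → ν m ℚ.* (ν n ℚ.* x)) (ℚΣ.∑-comm g) ⟩
  ν m ℚ.* (ν n ℚ.* sumℚ (λ j → sumℚ λ i → g i j)) ≡⟨ identity (ν m) (ν n) _ ⟩
  ν n ℚ.* (ν m ℚ.* sumℚ (λ j → sumℚ λ i → g i j)) ≡⟨ cong (ν n ℚ.*_) (ℚΣ.*-distribˡ-sum (ν m) λ j → sumℚ λ i → g i j) ⟩
  ν n ℚ.* sumℚ (λ j → ν m ℚ.* sumℚ λ i → g i j)   ∎
  where
  open ≡-Reasoning
  identity : ∀ a b c → a ℚ.* (b ℚ.* c) ≡ b ℚ.* (a ℚ.* c)
  identity = solve-∀ ringℚ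

module _ (n : ℕ) .{{_ : ℕ.NonZero n}} where

  -- The mean over a uniform tuple as iterated averages, which builds in the independence of the
  -- coordinates.
  𝔼 : ∀ k → (Vec (Fin n) k → ℚ) → ℚ
  𝔼 zero    f = f []
  𝔼 (suc k) f = avg n λ i → 𝔼 k λ x → f (i ∷ x)

  𝔼-mono : ∀ k {f g} → (∀ x → f x ℚ.≤ g x) → 𝔼 k f ℚ.≤ 𝔼 k g
  𝔼-mono zero    f≤g = f≤g []
  𝔼-mono (suc k) f≤g = avg-mono n λ i → 𝔼-mono k λ x → f≤g (i ∷ x)

  𝔼-cong : ∀ k {f g} → (∀ x → f x ≡ g x) → 𝔼 k f ≡ 𝔼 k g
  𝔼-cong zero    f≗g = f≗g []
  𝔼-cong (suc k) f≗g = avg-cong n λ i → 𝔼-cong k λ x → f≗g (i ∷ x)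

  𝔼-const : ∀ k p → 𝔼 k (λ _ → p) ≡ p
  𝔼-const zero    p = refl
  𝔼-const (suc k) p = trans (avg-cong n λ _ → 𝔼-const k p) (avg-const n p)

  𝔼-+ : ∀ k f g → 𝔼 k (λ x → f x ℚ.+ g x) ≡ 𝔼 k f ℚ.+ 𝔼 k g
  𝔼-+ zero    f g = refl
  𝔼-+ (suc k) f g = trans (avg-cong n λ i → 𝔼-+ k _ _) (avg-+ n _ _)

  𝔼-*ˡ : ∀ k p f → 𝔼 k (λ x → p ℚ.* f x) ≡ p ℚ.* 𝔼 k f
  𝔼-*ˡ zero    p f = refl
  𝔼-*ˡ (suc k) p f = trans (avg-cong n λ i → 𝔼-*ˡ k p _) (avg-*ˡ n p _)

  𝔼-avg : ∀ k m .{{_ : ℕ.NonZero m}} (w : Vec (Fin n) k → Fin m → ℚ) →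
    𝔼 k (λ x → avg m (w x)) ≡ avg m (λ j → 𝔼 k (λ x → w x j))
  𝔼-avg zero    m w = refl
  𝔼-avg (suc k) m w = trans (avg-cong n λ i → 𝔼-avg k m _) (avg-comm n m _)

bit : Bool → ℕ
bit b = if b then 1 else 0

-- Repeated coordinates count with multiplicity, so that this is a sum of independent indicators.
hits : ∀ {n k} → Vec (Fin n) k → Subset n → ℕ
hits []      S = 0
hits (i ∷ x) S = bit (lookup S i) ℕ.+ hits x S

hits-mono : ∀ {n k} (x : Vec (Fin n) k) {S T} → S ⊆ T → hits x S ℕ.≤ hits x T
hits-mono []      S⊆T = ℕ.z≤n
hits-mono (i ∷ x) {S} {T} S⊆T = ℕ.+-mono-≤ bit-mono (hits-mono x S⊆T)
  where
  bit-mono : bit (lookup S i) ℕ.≤ bit (lookup T i)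
  bit-mono with lookup S i in eq
  ... | false = ℕ.z≤n
  ... | true  rewrite Vec.[]=⇒lookup (S⊆T (Vec.lookup⇒[]= i S eq)) = ℕ.≤-refl

bit-modular : ∀ a b → bit (a ∨ b) ℕ.+ bit (a ∧ b) ≡ bit a ℕ.+ bit b
bit-modular false b     = ℕ.+-identityʳ (bit b)
bit-modular true  false = refl
bit-modular true  true  = refl

hits-modular : ∀ {n k} (x : Vec (Fin n) k) S T → hits x (S ∪ T) ℕ.+ hits x (S ∩ T) ≡ hits x S ℕ.+ hits x T
hits-modular []      S T = refl
hits-modular (i ∷ x) S T
  rewrite Vec.lookup-zipWith _∨_ i S T | Vec.lookup-zipWith _∧_ i S T =
  trans (interchange ℕ.+-commutativeSemigroup (bit (lookup S i ∨ lookup T i)) (hits x (S ∪ T)) _ (hits x (S ∩ T)))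
    (trans (cong₂ ℕ._+_ (bit-modular (lookup S i) (lookup T i)) (hits-modular x S T))
      (interchange ℕ.+-commutativeSemigroup (bit (lookup S i)) (bit (lookup T i)) (hits x S) (hits x T)))

∣∣-∷ : ∀ {n} b (S : Subset n) → ∣ b ∷ S ∣ ≡ bit b ℕ.+ ∣ S ∣
∣∣-∷ false S = refl
∣∣-∷ true  S = refl

∣∣-modular : ∀ {n} (S T : Subset n) → ∣ S ∪ T ∣ ℕ.+ ∣ S ∩ T ∣ ≡ ∣ S ∣ ℕ.+ ∣ T ∣
∣∣-modular []      []      = refl
∣∣-modular (a ∷ S) (b ∷ T)
  rewrite ∣∣-∷ (a ∨ b) (S ∪ T) | ∣∣-∷ (a ∧ b) (S ∩ T) | ∣∣-∷ a S | ∣∣-∷ b T =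
  trans (interchange ℕ.+-commutativeSemigroup (bit (a ∨ b)) (∣ S ∪ T ∣) _ (∣ S ∩ T ∣))
    (trans (cong₂ ℕ._+_ (bit-modular a b) (∣∣-modular S T)) (interchange ℕ.+-commutativeSemigroup (bit a) (bit b) (∣ S ∣) (∣ T ∣)))

support : ∀ {n k} → Vec (Fin n) k → Subset n
support []      = Subset.⊥
support (i ∷ x) = ⁅ i ⁆ ∪ support x

∣support∣≤ : ∀ {n k} (x : Vec (Fin n) k) → ∣ support x ∣ ℕ.≤ k
∣support∣≤ {n} []      = ℕ.≤-reflexive (Subset.∣⊥∣≡0 n)
∣support∣≤ {k = suc k} (i ∷ x) = begin
  ∣ ⁅ i ⁆ ∪ support x ∣                            ≤⟨ ℕ.m≤m+n _ _ ⟩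
  ∣ ⁅ i ⁆ ∪ support x ∣ ℕ.+ ∣ ⁅ i ⁆ ∩ support x ∣  ≡⟨ ∣∣-modular ⁅ i ⁆ (support x) ⟩
  ∣ ⁅ i ⁆ ∣ ℕ.+ ∣ support x ∣                      ≡⟨ cong (ℕ._+ ∣ support x ∣) (Subset.∣⁅x⁆∣≡1 i) ⟩
  suc ∣ support x ∣                                ≤⟨ ℕ.s≤s (∣support∣≤ x) ⟩
  suc k                                            ∎
  where open ℕ.≤-Reasoning

≤hits-support : ∀ {n k} (x : Vec (Fin n) k) → k ℕ.≤ hits x (support x)
≤hits-support []      = ℕ.z≤n
≤hits-support (i ∷ x) rewrite Vec.[]=⇒lookup (Subset.p⊆p∪q {p = ⁅ i ⁆} (support x) (Subset.x∈⁅x⁆ i)) =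
  ℕ.s≤s (ℕ.≤-trans (≤hits-support x) (hits-mono x (Subset.q⊆p∪q ⁅ i ⁆ (support x))))

-- The Chernoff bound

-- (1 + 1/N)^m ≤ 1 + m/N + (m/N)² for m ≤ N, without denominators.
[1+N]^m*N²≤ : ∀ {N} m → m ℕ.≤ N →
  suc N ℕ.^ m ℕ.* (N ℕ.* N) ℕ.≤ N ℕ.^ m ℕ.* (N ℕ.* N ℕ.+ m ℕ.* N ℕ.+ m ℕ.* m)
[1+N]^m*N²≤ {N} zero    _   = ℕ.≤-reflexive (identity N)
  where
  identity : ∀ N → 1 ℕ.* (N ℕ.* N) ≡ 1 ℕ.* (N ℕ.* N ℕ.+ 0 ℕ.* N ℕ.+ 0 ℕ.* 0)
  identity = solve-∀ℕ
[1+N]^m*N²≤ {N} (suc m) m<N = begin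
  suc N ℕ.* suc N ℕ.^ m ℕ.* (N ℕ.* N)                                     ≡⟨ ℕ.*-assoc (suc N) (suc N ℕ.^ m) (N ℕ.* N) ⟩
  suc N ℕ.* (suc N ℕ.^ m ℕ.* (N ℕ.* N))                                   ≤⟨ ℕ.*-monoʳ-≤ (suc N) ([1+N]^m*N²≤ m (ℕ.<⇒≤ m<N)) ⟩
  suc N ℕ.* (N ℕ.^ m ℕ.* (N ℕ.* N ℕ.+ m ℕ.* N ℕ.+ m ℕ.* m))               ≡⟨ identity₁ N m (N ℕ.^ m) ⟩
  N ℕ.^ m ℕ.* (N ℕ.* (N ℕ.* N ℕ.+ suc m ℕ.* N ℕ.+ m ℕ.* m) ℕ.+ m ℕ.* N ℕ.+ m ℕ.* m)
    ≤⟨ ℕ.*-monoʳ-≤ (N ℕ.^ m) (ℕ.+-mono-≤ (ℕ.≤-refl {N ℕ.* (N ℕ.* N ℕ.+ suc m ℕ.* N ℕ.+ m ℕ.* m) ℕ.+ m ℕ.* N}) (ℕ.*-monoʳ-≤ m (ℕ.<⇒≤ m<N))) ⟩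
  N ℕ.^ m ℕ.* (N ℕ.* (N ℕ.* N ℕ.+ suc m ℕ.* N ℕ.+ m ℕ.* m) ℕ.+ m ℕ.* N ℕ.+ m ℕ.* N)
    ≤⟨ ℕ.*-monoʳ-≤ (N ℕ.^ m) (ℕ.m≤m+n _ N) ⟩
  N ℕ.^ m ℕ.* (N ℕ.* (N ℕ.* N ℕ.+ suc m ℕ.* N ℕ.+ m ℕ.* m) ℕ.+ m ℕ.* N ℕ.+ m ℕ.* N ℕ.+ N)
    ≡⟨ identity₂ N m (N ℕ.^ m) ⟩
  N ℕ.* N ℕ.^ m ℕ.* (N ℕ.* N ℕ.+ suc m ℕ.* N ℕ.+ suc m ℕ.* suc m)         ∎
  where
  open ℕ.≤-Reasoning
  identity₁ : ∀ N m x → suc N ℕ.* (x ℕ.* (N ℕ.* N ℕ.+ m ℕ.* N ℕ.+ m ℕ.* m)) ≡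
    x ℕ.* (N ℕ.* (N ℕ.* N ℕ.+ suc m ℕ.* N ℕ.+ m ℕ.* m) ℕ.+ m ℕ.* N ℕ.+ m ℕ.* m)
  identity₁ = solve-∀ℕ
  identity₂ : ∀ N m x → x ℕ.* (N ℕ.* (N ℕ.* N ℕ.+ suc m ℕ.* N ℕ.+ m ℕ.* m) ℕ.+ m ℕ.* N ℕ.+ m ℕ.* N ℕ.+ N) ≡
    N ℕ.* x ℕ.* (N ℕ.* N ℕ.+ suc m ℕ.* N ℕ.+ suc m ℕ.* suc m)
  identity₂ = solve-∀ℕ

[1+N]^m≤4*N^m : ∀ {N} m .{{_ : ℕ.NonZero N}} → m ℕ.≤ N → suc N ℕ.^ m ℕ.≤ 4 ℕ.* N ℕ.^ m
[1+N]^m≤4*N^m {N} m m≤N = ℕ.*-cancelʳ-≤ (suc N ℕ.^ m) (4 ℕ.* N ℕ.^ m) (N ℕ.* N) {{ℕ.m*n≢0 N N}} (begin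
  suc N ℕ.^ m ℕ.* (N ℕ.* N)                              ≤⟨ [1+N]^m*N²≤ m m≤N ⟩
  N ℕ.^ m ℕ.* (N ℕ.* N ℕ.+ m ℕ.* N ℕ.+ m ℕ.* m)          ≤⟨ ℕ.*-monoʳ-≤ (N ℕ.^ m) (ℕ.+-mono-≤
                                                              (ℕ.+-monoʳ-≤ (N ℕ.* N) (ℕ.*-monoˡ-≤ N m≤N)) (ℕ.*-mono-≤ m≤N m≤N)) ⟩
  -- The estimate yields the factor 3; it is rounded up to 4, a power of two that combines with
  -- `2 ^ hits`.
  N ℕ.^ m ℕ.* (N ℕ.* N ℕ.+ N ℕ.* N ℕ.+ N ℕ.* N)          ≤⟨ ℕ.m≤m+n _ (N ℕ.^ m ℕ.* (N ℕ.* N)) ⟩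
  N ℕ.^ m ℕ.* (N ℕ.* N ℕ.+ N ℕ.* N ℕ.+ N ℕ.* N) ℕ.+ N ℕ.^ m ℕ.* (N ℕ.* N) ≡⟨ identity N (N ℕ.^ m) ⟩
  4 ℕ.* N ℕ.^ m ℕ.* (N ℕ.* N)                            ∎)
  where
  open ℕ.≤-Reasoning
  identity : ∀ N x → x ℕ.* (N ℕ.* N ℕ.+ N ℕ.* N ℕ.+ N ℕ.* N) ℕ.+ x ℕ.* (N ℕ.* N) ≡ 4 ℕ.* x ℕ.* (N ℕ.* N)
  identity = solve-∀ℕ

-- A discrete form of `(1 + s/n)^n ≤ exp(O(s))`: each unit added to `n + s` costs a factor of at
-- most 4, because the exponent `n` does not exceed the base.
[n+s]^n≤4^s*n^n : ∀ n .{{_ : ℕ.NonZero n}} s → (n ℕ.+ s) ℕ.^ n ℕ.≤ 4 ℕ.^ s ℕ.* n ℕ.^ n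
[n+s]^n≤4^s*n^n n zero    = ℕ.≤-reflexive (trans (cong (ℕ._^ n) (ℕ.+-identityʳ n)) (sym (ℕ.*-identityˡ (n ℕ.^ n))))
[n+s]^n≤4^s*n^n n@(suc _) (suc s) = begin
  (n ℕ.+ suc s) ℕ.^ n           ≡⟨ cong (ℕ._^ n) (ℕ.+-suc n s) ⟩
  suc (n ℕ.+ s) ℕ.^ n           ≤⟨ [1+N]^m≤4*N^m n (ℕ.m≤m+n n s) ⟩
  4 ℕ.* (n ℕ.+ s) ℕ.^ n         ≤⟨ ℕ.*-monoʳ-≤ 4 ([n+s]^n≤4^s*n^n n s) ⟩
  4 ℕ.* (4 ℕ.^ s ℕ.* n ℕ.^ n)   ≡⟨ sym (ℕ.*-assoc 4 (4 ℕ.^ s) (n ℕ.^ n)) ⟩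
  4 ℕ.^ suc s ℕ.* n ℕ.^ n       ∎
  where open ℕ.≤-Reasoning

^-cancelʳ-≤ : ∀ {a b} n .{{_ : ℕ.NonZero n}} → a ℕ.^ n ℕ.≤ b ℕ.^ n → a ℕ.≤ b
^-cancelʳ-≤ {a} {b} n a^n≤b^n with a ℕ.≤? b
... | yes a≤b = a≤b
... | no  a≰b = contradiction a^n≤b^n (ℕ.<⇒≱ (ℕ.^-monoˡ-< n (ℕ.≰⇒> a≰b)))

^-distribʳ-* : ∀ a b n → (a ℕ.* b) ℕ.^ n ≡ a ℕ.^ n ℕ.* b ℕ.^ n
^-distribʳ-* a b zero    = refl
^-distribʳ-* a b (suc n) = trans (cong (a ℕ.* b ℕ.*_) (^-distribʳ-* a b n))
  (interchange ℕ.*-commutativeSemigroup a b (a ℕ.^ n) (b ℕ.^ n))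

-- Comparing `n`-th powers brings in the exponent `n`, for which the previous bound is available,
-- without taking roots.
[n+s]^k≤4^r*n^k : ∀ n .{{_ : ℕ.NonZero n}} s k r → k ℕ.* s ℕ.≤ n ℕ.* r → (n ℕ.+ s) ℕ.^ k ℕ.≤ 4 ℕ.^ r ℕ.* n ℕ.^ k
[n+s]^k≤4^r*n^k n s k r ks≤nr = ^-cancelʳ-≤ n (begin
  ((n ℕ.+ s) ℕ.^ k) ℕ.^ n              ≡⟨ ^-swap (n ℕ.+ s) k n ⟩
  ((n ℕ.+ s) ℕ.^ n) ℕ.^ k              ≤⟨ ℕ.^-monoˡ-≤ k ([n+s]^n≤4^s*n^n n s) ⟩
  (4 ℕ.^ s ℕ.* n ℕ.^ n) ℕ.^ k          ≡⟨ ^-distribʳ-* (4 ℕ.^ s) (n ℕ.^ n) k ⟩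
  (4 ℕ.^ s) ℕ.^ k ℕ.* (n ℕ.^ n) ℕ.^ k  ≡⟨ cong₂ ℕ._*_ (trans (ℕ.^-*-assoc 4 s k) (cong (4 ℕ.^_) (ℕ.*-comm s k))) (^-swap n n k) ⟩
  4 ℕ.^ (k ℕ.* s) ℕ.* (n ℕ.^ k) ℕ.^ n  ≤⟨ ℕ.*-monoˡ-≤ ((n ℕ.^ k) ℕ.^ n) (ℕ.^-monoʳ-≤ 4 ks≤nr) ⟩
  4 ℕ.^ (n ℕ.* r) ℕ.* (n ℕ.^ k) ℕ.^ n  ≡⟨ cong (ℕ._* (n ℕ.^ k) ℕ.^ n) (trans (cong (4 ℕ.^_) (ℕ.*-comm n r)) (sym (ℕ.^-*-assoc 4 r n))) ⟩
  (4 ℕ.^ r) ℕ.^ n ℕ.* (n ℕ.^ k) ℕ.^ n  ≡⟨ sym (^-distribʳ-* (4 ℕ.^ r) (n ℕ.^ k) n) ⟩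
  (4 ℕ.^ r ℕ.* n ℕ.^ k) ℕ.^ n          ∎)
  where
  open ℕ.≤-Reasoning
  ^-swap : ∀ a b c → (a ℕ.^ b) ℕ.^ c ≡ (a ℕ.^ c) ℕ.^ b
  ^-swap a b c = trans (ℕ.^-*-assoc a b c) (trans (cong (a ℕ.^_) (ℕ.*-comm b c)) (sym (ℕ.^-*-assoc a c b)))

sum-2^bit : ∀ {n} (S : Subset n) → sumℚ (λ i → ι (2 ℕ.^ bit (lookup S i))) ≡ ι (n ℕ.+ ∣ S ∣)
sum-2^bit []      = sym ι-0
sum-2^bit {suc n} (b ∷ S) =
  trans (cong (ι (2 ℕ.^ bit b) ℚ.+_) (sum-2^bit S))
    (trans (sym (ι-homo-+ (2 ℕ.^ bit b) (n ℕ.+ ∣ S ∣))) (cong ι (count b)))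
  where
  count : ∀ b → 2 ℕ.^ bit b ℕ.+ (n ℕ.+ ∣ S ∣) ≡ suc n ℕ.+ ∣ b ∷ S ∣
  count false = refl
  count true  = cong suc (sym (ℕ.+-suc n ∣ S ∣))

[¬_] : ∀ {P : Set} → Dec P → ℚ
[¬ yes _ ] = 0ℚ
[¬ no  _ ] = 1ℚ

module _ (n : ℕ) .{{_ : ℕ.NonZero n}} where

  -- The moment generating function of `hits` at base 2: by independence it factors, and every
  -- coordinate contributes the mean `(n + |S|) / n`.
  𝔼-2^hits : ∀ k (S : Subset n) → 𝔼 n k (λ x → ι (2 ℕ.^ hits x S)) ≡ (ν n ℚ.* ι (n ℕ.+ ∣ S ∣)) ^ℚ k
  𝔼-2^hits zero    S = ι-1
  𝔼-2^hits (suc k) S = begin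
    avg n (λ i → 𝔼 n k λ x → ι (2 ℕ.^ (bit (lookup S i) ℕ.+ hits x S)))
      ≡⟨ avg-cong n (λ i → 𝔼-cong n k λ x → trans (cong ι (ℕ.^-distribˡ-+-* 2 (bit (lookup S i)) (hits x S))) (ι-homo-* (2 ℕ.^ bit (lookup S i)) (2 ℕ.^ hits x S))) ⟩
    avg n (λ i → 𝔼 n k λ x → ι (2 ℕ.^ bit (lookup S i)) ℚ.* ι (2 ℕ.^ hits x S))
      ≡⟨ avg-cong n (λ i → trans (𝔼-*ˡ n k (ι (2 ℕ.^ bit (lookup S i))) _)
           (trans (cong (ι (2 ℕ.^ bit (lookup S i)) ℚ.*_) (𝔼-2^hits k S)) (ℚ.*-comm _ (q ^ℚ k)))) ⟩
    avg n (λ i → q ^ℚ k ℚ.* ι (2 ℕ.^ bit (lookup S i)))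
      ≡⟨ avg-*ˡ n (q ^ℚ k) _ ⟩
    q ^ℚ k ℚ.* avg n (λ i → ι (2 ℕ.^ bit (lookup S i)))
      ≡⟨ cong (λ p → q ^ℚ k ℚ.* (ν n ℚ.* p)) (sum-2^bit S) ⟩
    q ^ℚ k ℚ.* q
      ≡⟨ ℚ.*-comm (q ^ℚ k) q ⟩
    q ^ℚ suc k ∎
    where
    open ≡-Reasoning
    q = ν n ℚ.* ι (n ℕ.+ ∣ S ∣)

  𝔼-2^hits≤ : ∀ k r (S : Subset n) → k ℕ.* ∣ S ∣ ℕ.≤ n ℕ.* r → 𝔼 n k (λ x → ι (2 ℕ.^ hits x S)) ℚ.≤ ι (4 ℕ.^ r)
  𝔼-2^hits≤ k r S ks≤nr = begin
    𝔼 n k (λ x → ι (2 ℕ.^ hits x S))            ≡⟨ 𝔼-2^hits k S ⟩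
    (ν n ℚ.* ι (n ℕ.+ ∣ S ∣)) ^ℚ k              ≡⟨ ℚ^.^-distrib-* (ν n) (ι (n ℕ.+ ∣ S ∣)) k ⟩
    ν n ^ℚ k ℚ.* ι (n ℕ.+ ∣ S ∣) ^ℚ k           ≡⟨ cong (ν n ^ℚ k ℚ.*_) (sym (ι-homo-^ (n ℕ.+ ∣ S ∣) k)) ⟩
    ν n ^ℚ k ℚ.* ι ((n ℕ.+ ∣ S ∣) ℕ.^ k)        ≤⟨ *-monoˡ-≤ (ν n ^ℚ k) (^-nonNeg k (0≤ν n)) (ι-mono-≤ ([n+s]^k≤4^r*n^k n ∣ S ∣ k r ks≤nr)) ⟩
    ν n ^ℚ k ℚ.* ι (4 ℕ.^ r ℕ.* n ℕ.^ k)        ≡⟨ cong (ν n ^ℚ k ℚ.*_) (trans (ι-homo-* (4 ℕ.^ r) (n ℕ.^ k)) (cong (ι (4 ℕ.^ r) ℚ.*_) (ι-homo-^ n k))) ⟩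
    ν n ^ℚ k ℚ.* (ι (4 ℕ.^ r) ℚ.* ι n ^ℚ k)     ≡⟨ identity (ν n ^ℚ k) (ι (4 ℕ.^ r)) (ι n ^ℚ k) ⟩
    ι (4 ℕ.^ r) ℚ.* (ν n ^ℚ k ℚ.* ι n ^ℚ k)     ≡⟨ cong (ι (4 ℕ.^ r) ℚ.*_) (trans (sym (ℚ^.^-distrib-* (ν n) (ι n) k))
                                                      (trans (cong (_^ℚ k) (ν*ι n)) (1^ k))) ⟩
    ι (4 ℕ.^ r) ℚ.* 1ℚ                          ≡⟨ ℚ.*-identityʳ (ι (4 ℕ.^ r)) ⟩
    ι (4 ℕ.^ r)                                 ∎
    where
    open ℚ.≤-Reasoning
    identity : ∀ a b c → a ℚ.* (b ℚ.* c) ≡ b ℚ.* (a ℚ.* c)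
    identity = solve-∀ ringℚ

  -- The mean number of hits is `k |S| / n`, so this is `n` times the threshold `t + 2 + 2 * mean`.
  -- The summand 2 absorbs rounding the mean up to an integer in the tail bound.
  base : ℕ → ℕ → Subset n → ℕ
  base k t S = n ℕ.* (t ℕ.+ 2) ℕ.+ 2 ℕ.* (k ℕ.* ∣ S ∣)

  Typical : ∀ {k} → ℕ → Vec (Fin n) k → Subset n → Set
  Typical {k} t x S = n ℕ.* hits x S ℕ.≤ base k t S

  typical? : ∀ {k} t (x : Vec (Fin n) k) S → Dec (Typical t x S)
  typical? {k} t x S = n ℕ.* hits x S ℕ.≤? base k t S

  atypical : ∀ {k} → ℕ → Vec (Fin n) k → Subset n → ℚ
  atypical t x S = [¬ typical? t x S ]

  -- Chernoff: 4 ^ r bounds the mean of 2 ^ hits, and an atypical S has at least t + 2 r hits.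
  𝔼-atypical≤ : ∀ k t S → 𝔼 n k (λ x → atypical t x S) ℚ.≤ ν (2 ℕ.^ t) {{ℕ.m^n≢0 2 t}}
  𝔼-atypical≤ k t S = ι≤ν⁻¹ (2 ℕ.^ t) {{ℕ.m^n≢0 2 t}} (*-cancelˡ-≤ (ι (4 ℕ.^ r)) (0<ι (4 ℕ.^ r) {{ℕ.m^n≢0 4 r}}) (begin
    ι (4 ℕ.^ r) ℚ.* (ι (2 ℕ.^ t) ℚ.* 𝔼 n k (λ x → atypical t x S))   ≡⟨ sym (ℚ.*-assoc (ι (4 ℕ.^ r)) (ι (2 ℕ.^ t)) _) ⟩
    ι (4 ℕ.^ r) ℚ.* ι (2 ℕ.^ t) ℚ.* 𝔼 n k (λ x → atypical t x S)     ≡⟨ sym (𝔼-*ˡ n k (ι (4 ℕ.^ r) ℚ.* ι (2 ℕ.^ t)) _) ⟩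
    𝔼 n k (λ x → ι (4 ℕ.^ r) ℚ.* ι (2 ℕ.^ t) ℚ.* atypical t x S)     ≤⟨ 𝔼-mono n k markov ⟩
    𝔼 n k (λ x → ι (2 ℕ.^ hits x S))                                ≤⟨ 𝔼-2^hits≤ k r S ks≤nr ⟩
    ι (4 ℕ.^ r)                                                     ≡⟨ sym (ℚ.*-identityʳ (ι (4 ℕ.^ r))) ⟩
    ι (4 ℕ.^ r) ℚ.* 1ℚ                                              ∎))
    where
    ks = k ℕ.* ∣ S ∣
    r = suc (ks ℕ./ n)
    ks≤nr : ks ℕ.≤ n ℕ.* r
    ks≤nr = begin
      ks                            ≡⟨ ℕ.m≡m%n+[m/n]*n ks n ⟩
      ks ℕ.% n ℕ.+ ks ℕ./ n ℕ.* n   ≤⟨ ℕ.+-monoˡ-≤ _ (ℕ.<⇒≤ (ℕ.m%n<n ks n)) ⟩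
      r ℕ.* n                       ≡⟨ ℕ.*-comm r n ⟩
      n ℕ.* r                       ∎
      where open ℕ.≤-Reasoning
    many-hits : ∀ (x : Vec (Fin n) k) → ¬ Typical t x S → t ℕ.+ 2 ℕ.* r ℕ.≤ hits x S
    many-hits x ¬typical = ℕ.<⇒≤ (ℕ.*-cancelˡ-< n _ _ (begin-strict
      n ℕ.* (t ℕ.+ 2 ℕ.* r)                               ≡⟨ identity n t (ks ℕ./ n) ⟩
      n ℕ.* (t ℕ.+ 2) ℕ.+ 2 ℕ.* (ks ℕ./ n ℕ.* n)          ≤⟨ ℕ.+-monoʳ-≤ (n ℕ.* (t ℕ.+ 2)) (ℕ.*-monoʳ-≤ 2 (ℕ.m/n*n≤m ks n)) ⟩
      base k t S                                          <⟨ ℕ.≰⇒> ¬typical ⟩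
      n ℕ.* hits x S                                      ∎))
      where
      open ℕ.≤-Reasoning
      identity : ∀ n t d → n ℕ.* (t ℕ.+ 2 ℕ.* suc d) ≡ n ℕ.* (t ℕ.+ 2) ℕ.+ 2 ℕ.* (d ℕ.* n)
      identity = solve-∀ℕ
    open ℚ.≤-Reasoning
    markov : ∀ (x : Vec (Fin n) k) → ι (4 ℕ.^ r) ℚ.* ι (2 ℕ.^ t) ℚ.* atypical t x S ℚ.≤ ι (2 ℕ.^ hits x S)
    markov x with typical? t x S
    ... | yes _ = begin
      ι (4 ℕ.^ r) ℚ.* ι (2 ℕ.^ t) ℚ.* 0ℚ   ≡⟨ ℚ.*-zeroʳ (ι (4 ℕ.^ r) ℚ.* ι (2 ℕ.^ t)) ⟩
      0ℚ                                   ≤⟨ 0≤ι _ ⟩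
      ι (2 ℕ.^ hits x S)                   ∎
    ... | no ¬typical = begin
      ι (4 ℕ.^ r) ℚ.* ι (2 ℕ.^ t) ℚ.* 1ℚ   ≡⟨ ℚ.*-identityʳ _ ⟩
      ι (4 ℕ.^ r) ℚ.* ι (2 ℕ.^ t)          ≡⟨ sym (ι-homo-* (4 ℕ.^ r) (2 ℕ.^ t)) ⟩
      ι (4 ℕ.^ r ℕ.* 2 ℕ.^ t)              ≤⟨ ι-mono-≤ (ℕ.≤-trans (ℕ.≤-reflexive power) (ℕ.^-monoʳ-≤ 2 (many-hits x ¬typical))) ⟩
      ι (2 ℕ.^ hits x S)                   ∎
      where
      power : 4 ℕ.^ r ℕ.* 2 ℕ.^ t ≡ 2 ℕ.^ (t ℕ.+ 2 ℕ.* r)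
      power = trans (cong (ℕ._* 2 ℕ.^ t) (ℕ.^-*-assoc 2 2 r))
        (trans (ℕ.*-comm (2 ℕ.^ (2 ℕ.* r)) (2 ℕ.^ t)) (sym (ℕ.^-distribˡ-+-* 2 t (2 ℕ.* r))))

-- Algorithms against a hidden random index

≤-avg : ∀ m .{{_ : ℕ.NonZero m}} {w r} → r ℚ.≤ + 1 / m ℚ.* sumℚ w → r ℚ.≤ avg m w
≤-avg m {w} {r} = subst (λ x → r ℚ.≤ x ℚ.* sumℚ w) (sym (ν≡1/ m))

module _ {n : ℕ} {f̃ : SetFunction n} {E : Subset n → Set} where

  ProbAtLeast⇒≤1 : ∀ {q} (a : Algorithm n q) {r} → ProbAtLeast f̃ E a r → r ℚ.≤ 1ℚ
  ProbAtLeast⇒≤1 (output S)  (inj₁ (_ , r≤1)) = r≤1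
  ProbAtLeast⇒≤1 (output S)  (inj₂ r≤0)       = ℚ.≤-trans r≤0 0≤1ℚ
  ProbAtLeast⇒≤1 (query S h) pr               = ProbAtLeast⇒≤1 (h (f̃ S)) pr
  ProbAtLeast⇒≤1 (toss m h)  (w , pr , r≤avg) = ℚ.≤-trans (≤-avg m r≤avg)
    (ℚ.≤-trans (avg-mono m λ i → ProbAtLeast⇒≤1 (h i) (pr i)) (ℚ.≤-reflexive (avg-const m 1ℚ)))

  ProbAtLeast-0 : ∀ {q} (a : Algorithm n q) → ProbAtLeast f̃ E a 0ℚ
  ProbAtLeast-0 (output S)  = inj₂ ℚ.≤-refl
  ProbAtLeast-0 (query S h) = ProbAtLeast-0 (h (f̃ S))
  ProbAtLeast-0 (toss m h)  = (λ _ → 0ℚ) , (λ i → ProbAtLeast-0 (h i)) ,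
    ℚ.≤-reflexive (sym (trans (cong (ℚ._* sumℚ {m} (λ _ → 0ℚ)) (sym (ν≡1/ m))) (avg-const m 0ℚ)))

-- The random index x selects the oracle f̃ x, which answers as the fixed oracle g except on the few
-- atypical sets; hence a run on g reveals nothing about x unless it meets an atypical set.
module Hiding
  {n : ℕ} .{{_ : ℕ.NonZero n}} {k : ℕ}
  {Typ : Vec (Fin n) k → Subset n → Set} (typ? : ∀ x S → Dec (Typ x S))
  {f̃ : Vec (Fin n) k → SetFunction n} {g : SetFunction n} (f̃≡g : ∀ {x S} → Typ x S → f̃ x S ≡ g S)
  {E : Vec (Fin n) k → Subset n → Set} (¬E : ∀ {x S} → Typ x S → ¬ E x S)
  {M : ℚ} (0≤M : 0ℚ ℚ.≤ M) (𝔼-¬typ≤ : ∀ S → 𝔼 n k (λ x → [¬ typ? x S ]) ℚ.≤ M)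
  where

  -- A union bound by induction on the algorithm: each query on a path and the final output cost at
  -- most `M` on average, whence `q + 1`.
  success≤ : ∀ {q} (a : Algorithm n q) {r} → (∀ x → ProbAtLeast (f̃ x) (E x) a (r x)) →
    𝔼 n k r ℚ.≤ ι (suc q) ℚ.* M
  success≤ {q} (output S) {r} pr = begin
    𝔼 n k r                        ≤⟨ 𝔼-mono n k r≤ ⟩
    𝔼 n k (λ x → [¬ typ? x S ])    ≤⟨ 𝔼-¬typ≤ S ⟩
    M                              ≡⟨ sym (ℚ.*-identityˡ M) ⟩
    1ℚ ℚ.* M                       ≡⟨ cong (ℚ._* M) (sym ι-1) ⟩
    -- An output may come before the query budget is spent.
    ι 1 ℚ.* M                      ≤⟨ *-monoʳ-≤ M 0≤M (ι-mono-≤ (ℕ.s≤s ℕ.z≤n)) ⟩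
    ι (suc q) ℚ.* M                ∎
    where
    open ℚ.≤-Reasoning
    r≤ : ∀ x → r x ℚ.≤ [¬ typ? x S ]
    r≤ x with typ? x S | pr x
    ... | yes typ | inj₁ (Ex , _) = contradiction Ex (¬E typ)
    ... | yes _   | inj₂ r≤0      = r≤0
    ... | no  _   | inj₁ (_ , r≤1) = r≤1
    ... | no  _   | inj₂ r≤0      = ℚ.≤-trans r≤0 0≤1ℚ
  success≤ {suc q} (query S h) {r} pr = begin
    𝔼 n k r                                       ≤⟨ 𝔼-mono n k r≤ ⟩
    𝔼 n k (λ x → r′ x ℚ.+ [¬ typ? x S ])          ≡⟨ 𝔼-+ n k r′ (λ x → [¬ typ? x S ]) ⟩
    𝔼 n k r′ ℚ.+ 𝔼 n k (λ x → [¬ typ? x S ])      ≤⟨ ℚ.+-mono-≤ (success≤ (h (g S)) pr′) (𝔼-¬typ≤ S) ⟩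
    ι (suc q) ℚ.* M ℚ.+ M                         ≡⟨ ℚ.+-comm (ι (suc q) ℚ.* M) M ⟩
    M ℚ.+ ι (suc q) ℚ.* M                         ≡⟨ cong (ℚ._+ ι (suc q) ℚ.* M) (trans (sym (ℚ.*-identityˡ M)) (cong (ℚ._* M) (sym ι-1))) ⟩
    ι 1 ℚ.* M ℚ.+ ι (suc q) ℚ.* M                 ≡⟨ trans (sym (ℚ.*-distribʳ-+ M (ι 1) (ι (suc q)))) (cong (ℚ._* M) (sym (ι-homo-+ 1 (suc q)))) ⟩
    ι (suc (suc q)) ℚ.* M                         ∎
    where
    open ℚ.≤-Reasoning
    -- For the indices at which the query is atypical, the claimed probability drops to 0, which any
    -- algorithm attains. All indices then continue into the same subtree `h (g S)`, and the dropped
    -- part is paid for by the indicator.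
    restrict : ∀ {P : Set} → Dec P → ℚ → ℚ
    restrict (yes _) p = p
    restrict (no  _) p = 0ℚ
    r′ : Vec (Fin n) k → ℚ
    r′ x = restrict (typ? x S) (r x)
    r≤ : ∀ x → r x ℚ.≤ r′ x ℚ.+ [¬ typ? x S ]
    r≤ x with typ? x S
    ... | yes _ = ℚ.≤-reflexive (sym (ℚ.+-identityʳ (r x)))
    ... | no  _ = ProbAtLeast⇒≤1 (query S h) (pr x)
    pr′ : ∀ x → ProbAtLeast (f̃ x) (E x) (h (g S)) (r′ x)
    pr′ x with typ? x S
    ... | yes typ = subst (λ y → ProbAtLeast (f̃ x) (E x) (h y) (r x)) (f̃≡g typ) (pr x)
    ... | no  _   = ProbAtLeast-0 (h (g S))
  success≤ {q} (toss m h) {r} pr = begin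
    𝔼 n k r                             ≤⟨ 𝔼-mono n k (λ x → ≤-avg m (proj₂ (proj₂ (pr x)))) ⟩
    -- Exchanging the two averages fixes the outcome of the toss first, so that the induction
    -- hypothesis applies to each branch.
    𝔼 n k (λ x → avg m (w x))           ≡⟨ 𝔼-avg n k m w ⟩
    avg m (λ i → 𝔼 n k (λ x → w x i))   ≤⟨ avg-mono m (λ i → success≤ (h i) (λ x → proj₁ (proj₂ (pr x)) i)) ⟩
    avg m (λ _ → ι (suc q) ℚ.* M)       ≡⟨ avg-const m (ι (suc q) ℚ.* M) ⟩
    ι (suc q) ℚ.* M                     ∎
    where
    open ℚ.≤-Reasoning
    w : Vec (Fin n) k → Fin m → ℚ
    w x = proj₁ (pr x)

-- The hard instances

module Instance (n : ℕ) .{{_ : ℕ.NonZero n}} (k t A : ℕ) .{{_ : ℕ.NonZero A}} where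

  value : Vec (Fin n) k → Subset n → ℕ
  value x S = n ℕ.* hits x S ℕ.+ A ℕ.* base n k t S

  f f̃ : Vec (Fin n) k → SetFunction n
  g : SetFunction n
  f x S = fromℕ (value x S)
  g S = fromℕ (A ℕ.* base n k t S)
  f̃ x S with typical? n t x S
  ... | yes _ = g S
  ... | no  _ = f x S

  f-monotone : ∀ x → Monotone (f x)
  f-monotone x S T S⊆T = fromℕ-mono-≤ (ℕ.+-mono-≤
    (ℕ.*-monoʳ-≤ n (hits-mono x S⊆T))
    (ℕ.*-monoʳ-≤ A (ℕ.+-monoʳ-≤ (n ℕ.* (t ℕ.+ 2))
      (ℕ.*-monoʳ-≤ 2 (ℕ.*-monoʳ-≤ k (Subset.p⊆q⇒∣p∣≤∣q∣ S⊆T))))))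

  value-modular : ∀ x S T → value x (S ∪ T) ℕ.+ value x (S ∩ T) ≡ value x S ℕ.+ value x T
  value-modular x S T = begin
    value x (S ∪ T) ℕ.+ value x (S ∩ T)
      ≡⟨ identity n A k (t ℕ.+ 2) (hits x (S ∪ T)) (hits x (S ∩ T)) (∣ S ∪ T ∣) (∣ S ∩ T ∣) ⟩
    total (hits x (S ∪ T) ℕ.+ hits x (S ∩ T)) (∣ S ∪ T ∣ ℕ.+ ∣ S ∩ T ∣)
      ≡⟨ cong₂ total (hits-modular x S T) (∣∣-modular S T) ⟩
    total (hits x S ℕ.+ hits x T) (∣ S ∣ ℕ.+ ∣ T ∣)
      ≡⟨ sym (identity n A k (t ℕ.+ 2) (hits x S) (hits x T) (∣ S ∣) (∣ T ∣)) ⟩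
    value x S ℕ.+ value x T ∎
    where
    open ≡-Reasoning
    total : ℕ → ℕ → ℕ
    total h s = n ℕ.* h ℕ.+ A ℕ.* (2 ℕ.* (n ℕ.* (t ℕ.+ 2)) ℕ.+ 2 ℕ.* (k ℕ.* s))
    identity : ∀ n A k t h h′ s s′ →
      (n ℕ.* h ℕ.+ A ℕ.* (n ℕ.* t ℕ.+ 2 ℕ.* (k ℕ.* s))) ℕ.+ (n ℕ.* h′ ℕ.+ A ℕ.* (n ℕ.* t ℕ.+ 2 ℕ.* (k ℕ.* s′))) ≡
      n ℕ.* (h ℕ.+ h′) ℕ.+ A ℕ.* (2 ℕ.* (n ℕ.* t) ℕ.+ 2 ℕ.* (k ℕ.* (s ℕ.+ s′)))
    identity = solve-∀ℕ

  f-submodular : ∀ x → Submodular (f x)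
  f-submodular x S T = fromℕ-≤-+- (value x (S ∪ T)) (value x S) (value x T) (value x (S ∩ T))
    (ℕ.≤-reflexive (value-modular x S T))

  typical-value≤ : ∀ x {S} → Typical n t x S → value x S ℕ.≤ suc A ℕ.* base n k t S
  typical-value≤ x {S} typ = ℕ.+-monoˡ-≤ (A ℕ.* base n k t S) typ

  -- The offset `t + 2` in `base` keeps every value positive, as `Erroneous-≤` requires.
  value≢0 : ∀ x S → ℕ.NonZero (value x S)
  value≢0 x S = ℕ.>-nonZero (ℕ.<-≤-trans (ℕ.>-nonZero⁻¹ (A ℕ.* (n ℕ.* (t ℕ.+ 2))) {{product≢0}})
    (ℕ.≤-trans (ℕ.*-monoʳ-≤ A (ℕ.m≤m+n (n ℕ.* (t ℕ.+ 2)) _)) (ℕ.m≤n+m _ (n ℕ.* hits x S))))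
    where
    product≢0 : ℕ.NonZero (A ℕ.* (n ℕ.* (t ℕ.+ 2)))
    product≢0 rewrite ℕ.+-comm t 2 = ℕ.m*n≢0 A (n ℕ.* suc (suc t)) {{it}} {{ℕ.m*n≢0 n (suc (suc t))}}

  -- On a typical set the answer is `A * base` and the true value at most `(A + 1) * base`, a ratio
  -- of at least `1 - 1/(A + 1)`; elsewhere the answer is exact. It never exceeds the true value,
  -- which gives the upper bound.
  f̃-erroneous : ∀ {ε} → 0ℝ < ε → ε ∋ ν (suc A) → ∀ x → Erroneous ε (f x) (f̃ x)
  f̃-erroneous {ε} 0<ε ε∋ν x S with typical? n t x S
  ... | yes typ = ≤-Erroneous ε (value x S) (A ℕ.* base n k t S) ε∋ν (*-cancelˡ-≤ (ι (suc A)) (0<ι (suc A)) (begin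
          ι (suc A) ℚ.* ((1ℚ ℚ.- ν (suc A)) ℚ.* ι (value x S))   ≡⟨ identity (ι (suc A)) (ν (suc A)) (ι (value x S)) ⟩
          (ι (suc A) ℚ.- ν (suc A) ℚ.* ι (suc A)) ℚ.* ι (value x S) ≡⟨ cong (ℚ._* ι (value x S)) 1+A-1 ⟩
          ι A ℚ.* ι (value x S)                                  ≡⟨ sym (ι-homo-* A (value x S)) ⟩
          ι (A ℕ.* value x S)                                    ≤⟨ ι-mono-≤ (ℕ.*-monoʳ-≤ A (typical-value≤ x typ)) ⟩
          ι (A ℕ.* (suc A ℕ.* base n k t S))                     ≡⟨ cong ι (swap A (suc A) (base n k t S)) ⟩
          ι (suc A ℕ.* (A ℕ.* base n k t S))                     ≡⟨ ι-homo-* (suc A) (A ℕ.* base n k t S) ⟩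
          ι (suc A) ℚ.* ι (A ℕ.* base n k t S)                   ∎))
        , Erroneous-≤ {ε} (value x S) {{value≢0 x S}} (A ℕ.* base n k t S) 0<ε (ℕ.m≤n+m (A ℕ.* base n k t S) (n ℕ.* hits x S))
    where
    open ℚ.≤-Reasoning
    identity : ∀ a e v → a ℚ.* ((1ℚ ℚ.- e) ℚ.* v) ≡ (a ℚ.- e ℚ.* a) ℚ.* v
    identity = solve-∀ ringℚ
    swap : ∀ a b c → a ℕ.* (b ℕ.* c) ≡ b ℕ.* (a ℕ.* c)
    swap = solve-∀ℕ
    cancel : ∀ a → 1ℚ ℚ.+ a ℚ.- 1ℚ ≡ a
    cancel = solve-∀ ringℚ
    1+A-1 : ι (suc A) ℚ.- ν (suc A) ℚ.* ι (suc A) ≡ ι A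
    1+A-1 = trans (cong₂ ℚ._-_ (trans (ι-homo-+ 1 A) (cong (ℚ._+ ι A) ι-1)) (ν*ι (suc A))) (cancel (ι A))
  ... | no  _   = ≤-Erroneous ε (value x S) (value x S) ε∋ν (subst ((1ℚ ℚ.- ν (suc A)) ℚ.* ι (value x S) ℚ.≤_) (ℚ.*-identityˡ (ι (value x S)))
                    (*-monoʳ-≤ (ι (value x S)) (0≤ι (value x S))
                      (subst (1ℚ ℚ.- ν (suc A) ℚ.≤_) (ℚ.+-identityʳ 1ℚ) (ℚ.+-monoʳ-≤ 1ℚ (ℚ.neg-antimono-≤ (0≤ν (suc A)))))))
                , Erroneous-≤ {ε} (value x S) {{value≢0 x S}} (value x S) 0<ε ℕ.≤-refl

  f̃-typical : ∀ {x S} → Typical n t x S → f̃ x S ≡ g S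
  f̃-typical {x} {S} typ with typical? n t x S
  ... | yes _ = refl
  ... | no ¬typ = contradiction typ ¬typ

  maxValue-∋ : ∀ x {q} → q ℚ.< ι (n ℕ.* k) → maxValue (f x) k ∋ q
  maxValue-∋ x q<nk =
    let (u , q<u , u<nk) = ℚ.<-dense q<nk
    in u , (support x , ∣support∣≤ x , fromℕ-∋ (value x (support x)) (ℚ.<-≤-trans u<nk (ι-mono-≤ nk≤))) , q<u
    where
    nk≤ : n ℕ.* k ℕ.≤ value x (support x)
    nk≤ = ℕ.≤-trans (ℕ.*-monoʳ-≤ n (≤hits-support x)) (ℕ.m≤m+n _ _)

  typical-value≤n : ∀ {j x S} → k ℕ.* k ℕ.≤ 4 ℕ.* n → 1 ℕ.≤ j → t ≡ 2 ℕ.* suc j → Typical n t x S → ∣ S ∣ ℕ.≤ k →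
    value x S ℕ.≤ 14 ℕ.* (suc A ℕ.* j ℕ.* n)
  typical-value≤n {j} {x} {S} k²≤4n 1≤j refl typ ∣S∣≤k = begin
    value x S                                                     ≤⟨ typical-value≤ x typ ⟩
    suc A ℕ.* (n ℕ.* (t ℕ.+ 2) ℕ.+ 2 ℕ.* (k ℕ.* ∣ S ∣))            ≤⟨ ℕ.*-monoʳ-≤ (suc A) (ℕ.+-monoʳ-≤ (n ℕ.* (t ℕ.+ 2))
                                                                      (ℕ.*-monoʳ-≤ 2 (ℕ.≤-trans (ℕ.*-monoʳ-≤ k ∣S∣≤k) k²≤4n))) ⟩
    suc A ℕ.* (n ℕ.* (t ℕ.+ 2) ℕ.+ 2 ℕ.* (4 ℕ.* n))               ≡⟨ identity₁ (suc A) n j ⟩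
    -- Of the 12, a part 4 comes from `t + 2 = 2 j + 4` and 8 from `2 k² ≤ 8 n`; it is absorbed by
    -- `1 ≤ j`.
    suc A ℕ.* n ℕ.* (2 ℕ.* j ℕ.+ 12 ℕ.* 1)                        ≤⟨ ℕ.*-monoʳ-≤ (suc A ℕ.* n) (ℕ.+-monoʳ-≤ (2 ℕ.* j) (ℕ.*-monoʳ-≤ 12 1≤j)) ⟩
    suc A ℕ.* n ℕ.* (2 ℕ.* j ℕ.+ 12 ℕ.* j)                        ≡⟨ identity₂ (suc A) n j ⟩
    14 ℕ.* (suc A ℕ.* j ℕ.* n)                                    ∎
    where
    open ℕ.≤-Reasoning
    identity₁ : ∀ D n j → D ℕ.* (n ℕ.* (2 ℕ.* suc j ℕ.+ 2) ℕ.+ 2 ℕ.* (4 ℕ.* n)) ≡ D ℕ.* n ℕ.* (2 ℕ.* j ℕ.+ 12 ℕ.* 1)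
    identity₁ = solve-∀ℕ
    identity₂ : ∀ D n j → D ℕ.* n ℕ.* (2 ℕ.* j ℕ.+ 12 ℕ.* j) ≡ 14 ℕ.* (D ℕ.* j ℕ.* n)
    identity₂ = solve-∀ℕ

-- Choice of the parameters

archimedean : ∀ p → ∃ λ N → p ℚ.≤ ι N
archimedean p@(mkℚ i d-1 _) = ℤ.∣ i ∣ , ℚ.toℚᵘ-cancel-≤
  (ℚᵘ.≤-respʳ-≃ (ℚᵘ.≃-sym (ι-toℚᵘ ℤ.∣ i ∣)) (ℚᵘ.*≤* (numerator≤ i)))
  where
  numerator≤ : ∀ i → i ℤ.* + 1 ℤ.≤ + ℤ.∣ i ∣ ℤ.* + suc d-1
  numerator≤ (+ m)    = ℤ.*-monoˡ-≤-nonNeg (+ m) (ℤ.+≤+ (ℕ.s≤s ℕ.z≤n))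
  numerator≤ -[1+ m ] = ℤ.-≤+

ν-archimedean : ∀ {p} → 0ℚ ℚ.< p → ∃ λ m → ν (suc m) ℚ.≤ p
ν-archimedean {p} 0<p = let (m , p⁻¹≤m) = archimedean p⁻¹ in m , (begin
  ν (suc m)                    ≡⟨ sym (trans (cong (ν (suc m) ℚ.*_) (ℚ.*-inverseˡ p)) (ℚ.*-identityʳ (ν (suc m)))) ⟩
  ν (suc m) ℚ.* (p⁻¹ ℚ.* p)    ≡⟨ sym (ℚ.*-assoc (ν (suc m)) p⁻¹ p) ⟩
  ν (suc m) ℚ.* p⁻¹ ℚ.* p      ≤⟨ *-monoʳ-≤ p (ℚ.<⇒≤ 0<p) (*-monoˡ-≤ (ν (suc m)) (0≤ν (suc m))
                                   (ℚ.≤-trans p⁻¹≤m (ι-mono-≤ (ℕ.n≤1+n m)))) ⟩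
  ν (suc m) ℚ.* ι (suc m) ℚ.* p ≡⟨ trans (cong (ℚ._* p) (ν*ι (suc m))) (ℚ.*-identityˡ p) ⟩
  p                            ∎)
  where
  open ℚ.≤-Reasoning
  instance
    p≢0 : ℚ.NonZero p
    p≢0 = ℚ.pos⇒nonZero p {{ℚ.positive 0<p}}
  p⁻¹ = ℚ.1/ p

ν-antimono : ∀ {m n} .{{_ : ℕ.NonZero m}} .{{_ : ℕ.NonZero n}} → m ℕ.≤ n → ν n ℚ.≤ ν m
ν-antimono {m} {n} m≤n = ι≤ν⁻¹ m (ℚ.≤-trans (*-monoʳ-≤ (ν n) (0≤ν n) (ι-mono-≤ m≤n))
  (ℚ.≤-reflexive (trans (ℚ.*-comm (ι n) (ν n)) (ν*ι n))))

-- A cut need not have a decidable lower set, so its integer part exists only under a double negation.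
¬¬integer-part : ∀ x J → x ∋ ι J → ¬ (∀ j → J ℕ.≤ j → x ∋ ι j → ¬ x ∌ ι (suc j))
¬¬integer-part x J x∋J k with ℝ.proper x
... | b , x∌b with archimedean b
...   | N , b≤N = climb N λ x∋N+J →
  x∌b (ℝ.down x (ℚ.≤-trans b≤N (ι-mono-≤ (ℕ.m≤m+n N J))) x∋N+J)
  where
  climb : ∀ i → ¬ ¬ (x ∋ ι (i ℕ.+ J))
  climb zero    x∌J     = x∌J x∋J
  climb (suc i) x∌1+i+J = climb i λ x∋i+J → k (i ℕ.+ J) (ℕ.m≤n+m J i) x∋i+J x∌1+i+J

-- Induction on `n`: `k` moves to `k + 1` only when `k²` equals the previous argument, and then
-- `(k + 1)² ≤ 4 (k² + 1)`.
√-approx : ∀ n .{{_ : ℕ.NonZero n}} → ∃ λ k → n ℕ.≤ k ℕ.* k × k ℕ.* k ℕ.≤ 4 ℕ.* n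
√-approx 1               = 1 , ℕ.≤-refl , ℕ.s≤s ℕ.z≤n
√-approx (suc (suc n)) with √-approx (suc n)
... | k , 1+n≤k² , k²≤4[1+n] with suc (suc n) ℕ.≤? k ℕ.* k
...   | yes 2+n≤k² = k , 2+n≤k² , ℕ.≤-trans k²≤4[1+n] (ℕ.*-monoʳ-≤ 4 (ℕ.n≤1+n (suc n)))
...   | no  2+n≰k² = suc k , lower , upper
  where
  k²≡ : k ℕ.* k ≡ suc n
  k²≡ = ℕ.≤-antisym (ℕ.≤-pred (ℕ.≰⇒> 2+n≰k²)) 1+n≤k²
  square : ∀ k → suc k ℕ.* suc k ≡ k ℕ.* k ℕ.+ 2 ℕ.* k ℕ.+ 1
  square = solve-∀ℕ
  k≤k² : ∀ k → k ℕ.≤ k ℕ.* k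
  k≤k² zero    = ℕ.z≤n
  k≤k² (suc k) = ℕ.m≤m*n (suc k) (suc k)
  open ℕ.≤-Reasoning
  lower : suc (suc n) ℕ.≤ suc k ℕ.* suc k
  lower = begin
    suc (suc n)              ≡⟨ cong suc (sym k²≡) ⟩
    suc (k ℕ.* k)            ≡⟨ ℕ.+-comm 1 (k ℕ.* k) ⟩
    k ℕ.* k ℕ.+ 1            ≤⟨ ℕ.+-monoˡ-≤ 1 (ℕ.m≤m+n (k ℕ.* k) (2 ℕ.* k)) ⟩
    k ℕ.* k ℕ.+ 2 ℕ.* k ℕ.+ 1 ≡⟨ sym (square k) ⟩
    suc k ℕ.* suc k          ∎
  upper : suc k ℕ.* suc k ℕ.≤ 4 ℕ.* suc (suc n)
  upper = begin
    suc k ℕ.* suc k                      ≡⟨ square k ⟩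
    k ℕ.* k ℕ.+ 2 ℕ.* k ℕ.+ 1            ≤⟨ ℕ.+-monoˡ-≤ 1 (ℕ.+-monoʳ-≤ (k ℕ.* k) (ℕ.*-monoʳ-≤ 2 (k≤k² k))) ⟩
    k ℕ.* k ℕ.+ 2 ℕ.* (k ℕ.* k) ℕ.+ 1    ≤⟨ ℕ.m≤m+n _ (k ℕ.* k ℕ.+ 3) ⟩
    k ℕ.* k ℕ.+ 2 ℕ.* (k ℕ.* k) ℕ.+ 1 ℕ.+ (k ℕ.* k ℕ.+ 3) ≡⟨ identity (k ℕ.* k) ⟩
    4 ℕ.* suc (k ℕ.* k)                  ≡⟨ cong (λ m → 4 ℕ.* suc m) k²≡ ⟩
    4 ℕ.* suc (suc n)                    ∎
    where
    identity : ∀ s → s ℕ.+ 2 ℕ.* s ℕ.+ 1 ℕ.+ (s ℕ.+ 3) ≡ 4 ℕ.* suc s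
    identity = solve-∀ℕ

-- From `x ≤ m` follows `e^ x ≤ 3 ^ m`, with `e` rounded up to 3. If `3 ^ m < q n`, then `3 ^ m / n`
-- would lie below `q`, hence below a product that cannot exceed it.
queries≤ : ∀ n .{{_ : ℕ.NonZero n}} x m q → x ∌ ι m → fromℕ q ≤ (e^ x) * fromℚ (+ 1 / n) → q ℕ.* n ℕ.≤ 3 ℕ.^ m
queries≤ n x m q x∌m q≤ = ℕ.≮⇒≥ λ 3^m<qn →
  ℚ.<-irrefl refl (*-fromℚ-∋⁻¹ (e^ x) (e^-∌ x m x∌m) (subst (0ℚ ℚ.≤_) (ν≡1/ n) (0≤ν n))
    (q≤ (fromℕ-∋ q (subst (ℚ._< ι q) eq (below 3^m<qn)))))
  where
  eq : ι (3 ℕ.^ m) ℚ.* ν n ≡ (+ 3 / 1) ^ℚ m ℚ.* (+ 1 / n)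
  eq = cong₂ ℚ._*_ (trans (ι-homo-^ 3 m) (cong (_^ℚ m) (ι≡/1 3))) (ν≡1/ n)
  open ℚ.≤-Reasoning
  below : 3 ℕ.^ m ℕ.< q ℕ.* n → ι (3 ℕ.^ m) ℚ.* ν n ℚ.< ι q
  below 3^m<qn = begin-strict
    ι (3 ℕ.^ m) ℚ.* ν n       <⟨ *-monoʳ-< (ν n) (0<ν n) (ι-mono-< 3^m<qn) ⟩
    ι (q ℕ.* n) ℚ.* ν n       ≡⟨ cong (ℚ._* ν n) (ι-homo-* q n) ⟩
    ι q ℚ.* ι n ℚ.* ν n       ≡⟨ ℚ.*-assoc (ι q) (ι n) (ν n) ⟩
    ι q ℚ.* (ι n ℚ.* ν n)     ≡⟨ cong (ι q ℚ.*_) (trans (ℚ.*-comm (ι n) (ν n)) (ν*ι n)) ⟩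
    ι q ℚ.* 1ℚ                ≡⟨ ℚ.*-identityʳ (ι q) ⟩
    ι q                       ∎

n<4^n : ∀ n → n ℕ.< 4 ℕ.^ n
n<4^n zero    = ℕ.s≤s ℕ.z≤n
n<4^n (suc n) = ℕ.≤-trans (ℕ.+-mono-≤ (ℕ.m^n>0 4 n) (n<4^n n)) (ℕ.+-monoʳ-≤ (4 ℕ.^ n) (ℕ.m≤m+n (4 ℕ.^ n) _))

-- With `t = 2 m` this says `(q + 1) / 2 ^ t < 1 / P`. After doubling, the term for the output is
-- absorbed by `m < 4 ^ m`, and the one for the queries by `q n ≤ 4 ^ m`: the division by `n` in the
-- query budget pays for `P`.
few-queries : ∀ {n m q} P → 2 ℕ.* P ℕ.≤ n → 2 ℕ.* P ℕ.≤ m → q ℕ.* n ℕ.≤ 3 ℕ.^ m → suc q ℕ.* P ℕ.< 2 ℕ.^ (2 ℕ.* m)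
few-queries {n} {m} {q} P 2P≤n 2P≤m qn≤3^m = ℕ.*-cancelˡ-< 2 _ _ (begin-strict
  2 ℕ.* (suc q ℕ.* P)                  ≡⟨ identity q P ⟩
  2 ℕ.* P ℕ.+ q ℕ.* (2 ℕ.* P)          ≤⟨ ℕ.+-mono-≤ 2P≤m (ℕ.*-monoʳ-≤ q 2P≤n) ⟩
  m ℕ.+ q ℕ.* n                        <⟨ ℕ.+-mono-<-≤ (n<4^n m) (ℕ.≤-trans qn≤3^m (ℕ.^-monoˡ-≤ m (ℕ.n≤1+n 3))) ⟩
  4 ℕ.^ m ℕ.+ 4 ℕ.^ m                  ≡⟨ cong (4 ℕ.^ m ℕ.+_) (sym (ℕ.+-identityʳ (4 ℕ.^ m))) ⟩
  2 ℕ.* 4 ℕ.^ m                        ≡⟨ cong (2 ℕ.*_) (ℕ.^-*-assoc 2 2 m) ⟩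
  2 ℕ.* 2 ℕ.^ (2 ℕ.* m)                ∎)
  where
  open ℕ.≤-Reasoning
  identity : ∀ q P → 2 ℕ.* (suc q ℕ.* P) ≡ 2 ℕ.* P ℕ.+ q ℕ.* (2 ℕ.* P)
  identity = solve-∀ℕ

ν*ν*ι≤1 : ∀ k n .{{_ : ℕ.NonZero k}} → n ℕ.≤ k ℕ.* k → ν k ℚ.* ν k ℚ.* ι n ℚ.≤ 1ℚ
ν*ν*ι≤1 k n n≤k² = begin
  ν k ℚ.* ν k ℚ.* ι n               ≤⟨ *-monoˡ-≤ _ (*-nonNeg (0≤ν k) (0≤ν k)) (ι-mono-≤ n≤k²) ⟩
  ν k ℚ.* ν k ℚ.* ι (k ℕ.* k)       ≡⟨ cong (ν k ℚ.* ν k ℚ.*_) (ι-homo-* k k) ⟩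
  ν k ℚ.* ν k ℚ.* (ι k ℚ.* ι k)     ≡⟨ interchangeℚ (ν k) (ν k) (ι k) (ι k) ⟩
  (ν k ℚ.* ι k) ℚ.* (ν k ℚ.* ι k)   ≡⟨ cong₂ ℚ._*_ (ν*ι k) (ν*ι k) ⟩
  1ℚ ℚ.* 1ℚ                         ≡⟨ ℚ.*-identityˡ 1ℚ ⟩
  1ℚ                                ∎
  where
  open ℚ.≤-Reasoning
  interchangeℚ : ∀ a b c d → a ℚ.* b ℚ.* (c ℚ.* d) ≡ (a ℚ.* c) ℚ.* (b ℚ.* d)
  interchangeℚ = solve-∀ ringℚ

-- Success probability on the hard instances

module _ (n : ℕ) .{{_ : ℕ.NonZero n}} (k j A : ℕ) .{{_ : ℕ.NonZero A}} .{{_ : ℕ.NonZero k}} .{{_ : ℕ.NonZero j}} where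

  open Instance n k (2 ℕ.* suc j) A

  ¬Approximates-typical : ∀ α → α ∋ ι (30 ℕ.* suc A) ℚ.* (ι j ℚ.* ν k) → k ℕ.* k ℕ.≤ 4 ℕ.* n →
    ∀ {x S} → Typical n (2 ℕ.* suc j) x S → ¬ Approximates (f x) k α S
  ¬Approximates-typical α α∋ρ k²≤4n {x} {S} typ (∣S∣≤k , α*max≤f) =
    ℚ.<-irrefl refl (ℚ.<-≤-trans
      (fromℕ-∋⁻¹ (value x S) (α*max≤f (*-∋ α (maxValue (f x) k) α∋ρ (maxValue-∋ x v<nk) 0≤ρ 0≤v y<ρv)))
      (ι-mono-≤ (typical-value≤n {x = x} k²≤4n (ℕ.>-nonZero⁻¹ j) refl typ ∣S∣≤k)))
    where
    D = suc A
    ρ = ι (30 ℕ.* D) ℚ.* (ι j ℚ.* ν k)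
    -- Membership in the maximum needs a rational strictly below `n k`. Half of it turns the factor
    -- 30 of `ρ` into 15, still above the 14 that bounds typical values.
    v = ½ ℚ.* ι (n ℕ.* k)
    0≤½ : 0ℚ ℚ.≤ ½
    0≤½ = ℚ.nonNegative⁻¹ ½
    0≤ρ : 0ℚ ℚ.≤ ρ
    0≤ρ = *-nonNeg (0≤ι (30 ℕ.* D)) (*-nonNeg (0≤ι j) (0≤ν k))
    0≤v : 0ℚ ℚ.≤ v
    0≤v = *-nonNeg 0≤½ (0≤ι (n ℕ.* k))
    v<nk : v ℚ.< ι (n ℕ.* k)
    v<nk = subst (v ℚ.<_) (ℚ.*-identityˡ (ι (n ℕ.* k)))
      (*-monoʳ-< (ι (n ℕ.* k)) (0<ι (n ℕ.* k) {{ℕ.m*n≢0 n k}}) ½<1)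
      where
      ½<1 : ½ ℚ.< 1ℚ
      ½<1 = ℚ.*<* (ℤ.+<+ (ℕ.s≤s (ℕ.s≤s ℕ.z≤n)))
    ½*ι : ∀ m → ½ ℚ.* ι (2 ℕ.* m) ≡ ι m
    ½*ι m = trans (cong (½ ℚ.*_) (trans (ι-homo-* 2 m) (cong (ℚ._* ι m) (ι≡/1 2))))
      (trans (sym (ℚ.*-assoc ½ (+ 2 / 1) (ι m))) (ℚ.*-identityˡ (ι m)))
    identity₁ : ∀ a b c d e h → a ℚ.* (b ℚ.* c) ℚ.* (h ℚ.* (d ℚ.* e)) ≡ h ℚ.* (a ℚ.* b ℚ.* d) ℚ.* (c ℚ.* e)
    identity₁ = solve-∀ ringℚ
    identity₂ : ∀ D j n → 30 ℕ.* D ℕ.* j ℕ.* n ≡ 2 ℕ.* (15 ℕ.* (D ℕ.* j ℕ.* n))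
    identity₂ = solve-∀ℕ
    ρv≡ : ρ ℚ.* v ≡ ι (15 ℕ.* (D ℕ.* j ℕ.* n))
    ρv≡ = begin
      ρ ℚ.* v                                                     ≡⟨ cong (λ z → ρ ℚ.* (½ ℚ.* z)) (ι-homo-* n k) ⟩
      ρ ℚ.* (½ ℚ.* (ι n ℚ.* ι k))                                 ≡⟨ identity₁ (ι (30 ℕ.* D)) (ι j) (ν k) (ι n) (ι k) ½ ⟩
      ½ ℚ.* (ι (30 ℕ.* D) ℚ.* ι j ℚ.* ι n) ℚ.* (ν k ℚ.* ι k)      ≡⟨ trans (cong (½ ℚ.* (ι (30 ℕ.* D) ℚ.* ι j ℚ.* ι n) ℚ.*_) (ν*ι k)) (ℚ.*-identityʳ _) ⟩
      ½ ℚ.* (ι (30 ℕ.* D) ℚ.* ι j ℚ.* ι n)                        ≡⟨ cong (λ z → ½ ℚ.* (z ℚ.* ι n)) (sym (ι-homo-* (30 ℕ.* D) j)) ⟩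
      ½ ℚ.* (ι (30 ℕ.* D ℕ.* j) ℚ.* ι n)                          ≡⟨ cong (½ ℚ.*_) (sym (ι-homo-* (30 ℕ.* D ℕ.* j) n)) ⟩
      ½ ℚ.* ι (30 ℕ.* D ℕ.* j ℕ.* n)                              ≡⟨ cong (λ z → ½ ℚ.* ι z) (identity₂ D j n) ⟩
      ½ ℚ.* ι (2 ℕ.* (15 ℕ.* (D ℕ.* j ℕ.* n)))                    ≡⟨ ½*ι (15 ℕ.* (D ℕ.* j ℕ.* n)) ⟩
      ι (15 ℕ.* (D ℕ.* j ℕ.* n))                                  ∎
      where open ≡-Reasoning
    y<ρv : ι (14 ℕ.* (D ℕ.* j ℕ.* n)) ℚ.< ρ ℚ.* v
    y<ρv = subst (ι (14 ℕ.* (D ℕ.* j ℕ.* n)) ℚ.<_) (sym ρv≡)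
      (ι-mono-< (ℕ.*-monoˡ-< (D ℕ.* j ℕ.* n) {{ℕ.m*n≢0 (D ℕ.* j) n {{ℕ.m*n≢0 D j}}}} (ℕ.n<1+n 14)))

  -- The guarantee `p` holds at every index `x`, so it equals its own mean over `x`, which the
  -- hiding argument bounds.
  success-probability≤ : ∀ {ε α} → 0ℝ < ε → ε ∋ ν (suc A) → α ∋ ι (30 ℕ.* suc A) ℚ.* (ι j ℚ.* ν k) → k ℕ.* k ℕ.≤ 4 ℕ.* n →
    ∀ {q} (𝒜 : ℕ → Algorithm n q) {p} → ObtainsApproximation 𝒜 ε α p →
    p ℚ.≤ ι (suc q) ℚ.* ν (2 ℕ.^ (2 ℕ.* suc j)) {{ℕ.m^n≢0 2 (2 ℕ.* suc j)}}
  success-probability≤ {ε} {α} 0<ε ε∋ν α∋ρ k²≤4n 𝒜 {p} obtains =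
    subst (ℚ._≤ _) (𝔼-const n k p)
      (Hiding.success≤ (typical? n (2 ℕ.* suc j)) (λ {x} → f̃-typical {x})
        (λ {x} typ → ¬Approximates-typical α α∋ρ k²≤4n {x} typ) (0≤ν _ {{ℕ.m^n≢0 2 (2 ℕ.* suc j)}})
        (𝔼-atypical≤ n k (2 ℕ.* suc j)) (𝒜 k)
        (λ x → obtains (f x) (f-monotone x) (f-submodular x) (f̃ x) (f̃-erroneous {ε} 0<ε ε∋ν x) k))

-- Contradiction for large `n`

module _
  {ε δ : ℝ} (0<ε : 0ℝ < ε) (δ<½ : δ < ½ℝ)
  {A : ℕ} .{{_ : ℕ.NonZero A}} (ε∋ν : ε ∋ ν (suc A))
  {s : ℚ} (δ∋s : δ ∋ s) (0<s : 0ℚ ℚ.< s)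
  {P : ℕ} .{{_ : ℕ.NonZero P}} {p : ℚ} (νP≤p : ν P ℚ.≤ p)
  {n : ℕ} .{{_ : ℕ.NonZero n}} (2P^s<n : suc (2 ℕ.* P) ℕ.^ ↧ₙ s ℕ.< n) (2P≤n : 2 ℕ.* P ℕ.≤ n)
  {q : ℕ} (q≤ : fromℕ q ≤ (e^ (n ^ δ)) * fromℚ (+ 1 / n))
  {α : ℝ} (<α : fromℕ (31 ℕ.* suc A) * (n ^ (- ½ℝ + δ)) < α)
  where

  -- The constant 31 in the hypothesis against 30 here makes the factor a strict lower bound, as
  -- membership in a cut demands, and `j / k` lies below `n ^ (- ½ℝ + δ)` because
  -- `1 / k ≤ n ^ (-1/2)`.
  ρ-below : ∀ k j .{{_ : ℕ.NonZero k}} .{{_ : ℕ.NonZero j}} → n ℕ.≤ k ℕ.* k → n ^ δ ∋ ι j →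
    α ∋ ι (30 ℕ.* suc A) ℚ.* (ι j ℚ.* ν k)
  ρ-below k j n≤k² ∋j = let (r , ∌r , α∋r) = <α in ℝ.down α
    (ℚ.≮⇒≥ λ r<ρ → ∌r (*-∋ (fromℕ (31 ℕ.* suc A)) (n ^ (- ½ℝ + δ))
      (fromℕ-∋ (31 ℕ.* suc A) (ι-mono-< (ℕ.*-monoˡ-< (suc A) (ℕ.n<1+n 30))))
      (^-½-∋ n δ j δ<½ (0<ν k) (ν*ν*ι≤1 k n n≤k²) ∋j)
      (0≤ι (30 ℕ.* suc A)) (*-nonNeg (0≤ι j) (0≤ν k)) r<ρ)) α∋r

  -- Clears the denominators in `1 / P ≤ p ≤ (q + 1) / 2 ^ t`.
  queries-suffice : ∀ k j .{{_ : ℕ.NonZero k}} .{{_ : ℕ.NonZero j}} → n ℕ.≤ k ℕ.* k → k ℕ.* k ℕ.≤ 4 ℕ.* n →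
    n ^ δ ∋ ι j → (𝒜 : ℕ → Algorithm n q) → ObtainsApproximation 𝒜 ε α p → 2 ℕ.^ (2 ℕ.* suc j) ℕ.≤ suc q ℕ.* P
  queries-suffice k j n≤k² k²≤4n ∋j 𝒜 obtains = ι-cancel-≤ (begin
    ι N                                    ≡⟨ sym (ℚ.*-identityʳ (ι N)) ⟩
    ι N ℚ.* 1ℚ                             ≡⟨ cong (ι N ℚ.*_) (sym (ν*ι P)) ⟩
    ι N ℚ.* (ν P ℚ.* ι P)                  ≤⟨ *-monoˡ-≤ (ι N) (0≤ι N) (*-monoʳ-≤ (ι P) (0≤ι P) (ℚ.≤-trans νP≤p
                                                (success-probability≤ n k j A {ε} {α} 0<ε ε∋ν (ρ-below k j n≤k² ∋j) k²≤4n 𝒜 obtains))) ⟩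
    ι N ℚ.* (ι (suc q) ℚ.* ν N ℚ.* ι P)    ≡⟨ identity (ι N) (ι (suc q)) (ν N) (ι P) ⟩
    (ν N ℚ.* ι N) ℚ.* (ι (suc q) ℚ.* ι P)  ≡⟨ trans (cong (ℚ._* (ι (suc q) ℚ.* ι P)) (ν*ι N)) (ℚ.*-identityˡ _) ⟩
    ι (suc q) ℚ.* ι P                      ≡⟨ sym (ι-homo-* (suc q) P) ⟩
    ι (suc q ℕ.* P)                        ∎)
    where
    N = 2 ℕ.^ (2 ℕ.* suc j)
    instance
      N≢0 : ℕ.NonZero N
      N≢0 = ℕ.m^n≢0 2 (2 ℕ.* suc j)
    identity : ∀ a b c d → a ℚ.* (b ℚ.* c ℚ.* d) ≡ (c ℚ.* a) ℚ.* (b ℚ.* d)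
    identity = solve-∀ ringℚ
    open ℚ.≤-Reasoning

  ¬ObtainsApproximation : ∀ (𝒜 : ℕ → Algorithm n q) → ¬ ObtainsApproximation 𝒜 ε α p
  ¬ObtainsApproximation 𝒜 obtains =
    let (k , n≤k² , k²≤4n) = √-approx n
        k≢0 = ℕ.m*n≢0⇒m≢0 k {{ℕ.>-nonZero (ℕ.<-≤-trans (ℕ.>-nonZero⁻¹ n) n≤k²)}}
        0<2P = ℕ.>-nonZero⁻¹ (2 ℕ.* P) {{ℕ.m*n≢0 2 P}}
    -- The goal is a negation, so the integer part `j` of `n ^ δ` may be used. The lower bound `j`
    -- enters the approximation ratio, the upper bound `j + 1` limits the queries, and
    -- `t = 2 (j + 1)`.
    in ¬¬integer-part (n ^ δ) (2 ℕ.* P) (^-∋-ι n δ s (2 ℕ.* P) δ∋s 0<s 2P^s<n) λ j 2P≤j ∋j ∌1+j →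
      ℕ.<⇒≱ (few-queries {n} {suc j} {q} P 2P≤n (ℕ.≤-trans 2P≤j (ℕ.n≤1+n j)) (queries≤ n (n ^ δ) (suc j) q ∌1+j q≤))
        (queries-suffice k j {{k≢0}} {{ℕ.>-nonZero (ℕ.<-≤-trans 0<2P 2P≤j)}} n≤k² k²≤4n ∋j 𝒜 obtains)

theorem6p1 : ∀ (ε δ : ℝ) → 0ℝ < ε → ε < ½ℝ → 0ℝ < δ → δ < ½ℝ →
    ∃ λ (C : ℝ) → ∀ (p : ℚ) → 0ℚ ℚ.< p →
    ∃ λ (n₀ : ℕ) → ∀ (n : ℕ) .{{_ : ℕ.NonZero n}} → n₀ ℕ.≤ n →
    ∀ (q : ℕ) → fromℕ q ≤ (e^ (n ^ δ)) * fromℚ (+ 1 / n) →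
    ∀ (α : ℝ) → C * (n ^ (- ½ℝ + δ)) < α →
    ∀ (A : ℕ → Algorithm n q) → ¬ ObtainsApproximation A ε α p
theorem6p1 ε δ 0<ε ε<½ 0<δ δ<½ =
  let (e′ , 0<e′ , ε∋e′) = ℝ.rounded ε (0ℝ<⇒∋0 {ε} 0<ε)
      (s , 0<s , δ∋s)    = ℝ.rounded δ (0ℝ<⇒∋0 {δ} 0<δ)
      (a , ν≤e′)         = ν-archimedean 0<e′
      -- The denominator is `2 + a` rather than `1 + a` so that `A = 1 + a` is nonzero.
      ε∋ν : ε ∋ ν (2 ℕ.+ a)
      ε∋ν = ℝ.down ε (ℚ.≤-trans (ν-antimono (ℕ.n≤1+n (suc a))) ν≤e′) ε∋e′
  -- The constant depends on `ε` alone and is fixed before `p`.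
  in fromℕ (31 ℕ.* (2 ℕ.+ a)) , λ p 0<p →
  let (P-1 , ν≤p) = ν-archimedean 0<p
      J = 2 ℕ.* suc P-1
      -- From `m ≤ n` it follows that `n ^ δ` exceeds `J = 2 P`; the summand `J` of the threshold
      -- gives `2 P ≤ n`.
      m = suc (suc J ℕ.^ ↧ₙ s)
  in m ℕ.+ J , λ n m+J≤n q q≤ α <α →
    ¬ObtainsApproximation {ε} {δ} 0<ε δ<½ {suc a} ε∋ν {s} δ∋s 0<s {suc P-1} ν≤p {n}
      (ℕ.≤-trans (ℕ.m≤m+n m J) m+J≤n) (ℕ.≤-trans (ℕ.m≤n+m J m) m+J≤n) {q} q≤ {α} <α
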